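{- Let $\nu,\mu$ be computable probability measures on Cantor space $2^{\mathbb{N}}$ with full support. Let $L(\tau)=-\ln \frac{\mu(\tau)}{\nu(\tau)}$ for $\tau\in 2^{<\mathbb{N}}$, which is a computable dyadic $\nu$-submartingale, and let $A$ be the predictable process from the Doob decomposition of $L$. Then, for all $n\ge 0$ and $\omega\in 2^{\mathbb{N}}$, $$D_{\mathscr{F}_{n+1}}(\nu \mid \mu)(\omega) = A(\omega\upharpoonright (n+1))-A(\omega\upharpoonright n).$$
   Context: A probability measure $\nu$ on Cantor space is identified with the function $\sigma\mapsto\nu(\sigma):=\nu([\sigma])$ on $2^{<\mathbb{N}}$, where $[\sigma]$ is the set of $\omega\in 2^{\mathbb{N}}$ extending $\sigma$. It is computable if the reals $\nu(\sigma)$ are computable uniformly in $\sigma$; it has full support if $\nu(\sigma)>0$ for all $\sigma$. $\omega\upharpoonright n$ is the length-$n$ initial segment of $\omega$. $\mathscr{F}_n$ is the $\sigma$-algebra generated by the sets $[\sigma]$ with $|\sigma|=n$. $\nu(\sigma\iota\mid\sigma)=\nu(\sigma\iota)/\nu(\sigma)$. Kullback-Leibler divergence: for probability measures $P\ll Q$ on a $\sigma$-algebra, $D(P\mid Q)=\mathbb{E}_P[\ln \frac{dP}{dQ}]$. $D_{\mathscr{F}_{n+1}}(\nu\mid\mu)(\omega)$ denotes $D(P\mid Q)$ where $P,Q$ are the restrictions to $\mathscr{F}_{n+1}$ of the conditional measures $\nu(\cdot\mid[\omega\upharpoonright n])$ and $\mu(\cdot\mid[\omega\upharpoonright n])$,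 respectively. A dyadic $\nu$-martingale is a function $M:2^{<\mathbb{N}}\to\mathbb{R}$ with $M(\sigma)=M(\sigma0)\nu(\sigma0\mid\sigma)+M(\sigma1)\nu(\sigma1\mid\sigma)$ for all $\sigma$; a dyadic $\nu$-submartingale is defined with $=$ replaced by $\le$; computable means $M(\sigma)$ is a computable real uniformly in $\sigma$. The Doob decomposition of a computable dyadic $\nu$-submartingale $L$ is the unique pair $(N,A)$ of a computable dyadic $\nu$-martingale $N$ and a non-negative computable $A:2^{<\mathbb{N}}\to\mathbb{R}$, increasing along extension of strings, such that $L=N+A$, $N(\emptyset)=L(\emptyset)$, and $A(\tau\iota)-A(\tau)=\big(L(\tau0)\nu(\tau0\mid\tau)+L(\tau1)\nu(\tau1\mid\tau)\big)-L(\tau)$ for all $\tau\in2^{<\mathbb{N}}$, $\iota\in\{0,1\}$. $A$ is called the predictable process. -}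

module Defs where

open import Data.Bool using (Bool; true; false; not; if_then_else_)
open import Data.Fin using (Fin)
open import Data.Integer as ℤ using (+_; _⊖_)
import Data.Integer.Properties as ℤₚ
open import Data.List using (List; []; _∷_; _∷ʳ_; _++_; applyUpTo)
open import Data.Maybe as Maybe using (Maybe; just; nothing)
open import Data.Nat as ℕ using (ℕ; zero; suc)
import Data.Nat.Properties as ℕₚ
open import Data.Product using (Σ; ∃-syntax; _×_; _,_; proj₁; proj₂)
open import Data.Rational as ℚ using (ℚ; 0ℚ; 1ℚ)
import Data.Rational.Properties as ℚₚ
import Data.Rational.Unnormalised as ℚᵘ
import Data.Rational.Unnormalised.Properties as ℚᵘₚ
open import Data.Rational.Solver using (module +-*-Solver)
open import Data.Sum using (inj₁; inj₂)
open import Data.Vec as Vec using (Vec; []; _∷_; toList)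
open import Data.Vec.Relation.Binary.Pointwise.Inductive using (Pointwise)
open import Function using (_∘_)
open import Relation.Binary.PropositionalEquality
  using (_≡_; refl; sym; trans; cong; cong₂; subst; subst₂)
open import Relation.Nullary using (yes; no; contradiction)

------------------------------------------------------------------------
-- Rational approximations

fromℕ : ℕ → ℚ
fromℕ n = + n ℚ./ 1

-- The reciprocal, with 1/0 = 0.
recip : ℚ → ℚ
recip q with q ℚₚ.≟ 0ℚ
... | yes _   = 0ℚ
... | no  q≢0 = ℚ.1/_ q ⦃ ℚ.≢-nonZero q≢0 ⦄

∑< : ℕ → (ℕ → ℚ) → ℚ
∑< zero    f = 0ℚ
∑< (suc n) f = ∑< n f ℚ.+ f n

-- The n-th left Riemann sum of ∫₁^q dt/t, on the uniform partition of
-- [1, q] (or [q, 1], with negative step, when q < 1).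
riemann : ℕ → ℚ → ℚ
riemann n q = ∑< n (λ i → h ℚ.* recip (1ℚ ℚ.+ fromℕ i ℚ.* h))
  where h = (q ℚ.- 1ℚ) ℚ.* recip (fromℕ n)

Cauchy : (ℕ → ℚ) → Set
Cauchy s = ∀ ε → 0ℚ ℚ.< ε →
  ∃[ N ] (∀ m n → N ℕ.≤ m → N ℕ.≤ n → ℚ.∣ s m ℚ.- s n ∣ ℚ.≤ ε)

Eventually : (ℕ → Set) → Set
Eventually P = ∃[ N ] (∀ n → N ℕ.≤ n → P n)

module Estimates where
  open import Data.Rational
  open ℚₚ
  open +-*-Solver
  open ≤-Reasoning

  recip-*ʳ : ∀ {q} → 0ℚ < q → q * recip q ≡ 1ℚ
  recip-*ʳ {q} 0<q with q ℚₚ.≟ 0ℚ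
  ... | yes q≡0 = contradiction (sym q≡0) (<⇒≢ 0<q)
  ... | no  q≢0 = *-inverseʳ q ⦃ ≢-nonZero q≢0 ⦄

  recip-pos : ∀ {q} → 0ℚ < q → 0ℚ < recip q
  recip-pos {q} 0<q with q ℚₚ.≟ 0ℚ
  ... | yes q≡0 = contradiction (sym q≡0) (<⇒≢ 0<q)
  ... | no  q≢0 = positive⁻¹ _ ⦃ 1/pos⇒pos q ⦃ positive 0<q ⦄ ⦄

  *-mono-≤ : ∀ {a b c d} → 0ℚ ≤ a → 0ℚ ≤ d → a ≤ b → c ≤ d → a * c ≤ b * d
  *-mono-≤ {a} {b} {c} {d} 0≤a 0≤d a≤b c≤d = begin
    a * c ≤⟨ *-monoˡ-≤-nonNeg a ⦃ nonNegative 0≤a ⦄ c≤d ⟩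
    a * d ≤⟨ *-monoʳ-≤-nonNeg d ⦃ nonNegative 0≤d ⦄ a≤b ⟩
    b * d ∎

  *-nonneg : ∀ {a b} → 0ℚ ≤ a → 0ℚ ≤ b → 0ℚ ≤ a * b
  *-nonneg {a} {b} 0≤a 0≤b = begin
    0ℚ     ≡⟨ sym (*-zeroʳ a) ⟩
    a * 0ℚ ≤⟨ *-monoˡ-≤-nonNeg a ⦃ nonNegative 0≤a ⦄ 0≤b ⟩
    a * b  ∎

  *-pos : ∀ {a b} → 0ℚ < a → 0ℚ < b → 0ℚ < a * b
  *-pos {a} {b} 0<a 0<b = positive⁻¹ _ ⦃ pos*pos⇒pos a ⦃ positive 0<a ⦄ b ⦃ positive 0<b ⦄ ⦄

  +-pos : ∀ {a b} → 0ℚ < a → 0ℚ < b → 0ℚ < a + b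
  +-pos 0<a 0<b = +-mono-< 0<a 0<b

  0<1 : 0ℚ < 1ℚ
  0<1 = positive⁻¹ 1ℚ

  recip-antimono : ∀ {a b} → 0ℚ < a → a ≤ b → recip b ≤ recip a
  recip-antimono {a} {b} 0<a a≤b = begin
    recip b                   ≡⟨ sym (*-identityˡ _) ⟩
    1ℚ * recip b              ≡⟨ cong (_* recip b) (sym (recip-*ʳ 0<a)) ⟩
    a * recip a * recip b     ≡⟨ solve 3 (λ x y z → x :* y :* z := x :* (y :* z)) refl a _ _ ⟩
    a * (recip a * recip b)   ≤⟨ *-monoʳ-≤-nonNeg _ ⦃ nonNegative (*-nonneg (<⇒≤ (recip-pos 0<a)) (<⇒≤ (recip-pos 0<b))) ⦄ a≤b ⟩
    b * (recip a * recip b)   ≡⟨ solve 3 (λ x y z → x :* (y :* z) := x :* z :* y) refl b _ _ ⟩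
    b * recip b * recip a     ≡⟨ cong (_* recip a) (recip-*ʳ 0<b) ⟩
    1ℚ * recip a              ≡⟨ *-identityˡ _ ⟩
    recip a                   ∎
    where 0<b = <-≤-trans 0<a a≤b

  p≤∣p∣ : ∀ p → p ≤ ∣ p ∣
  p≤∣p∣ p with ≤-total 0ℚ p
  ... | inj₁ 0≤p = ≤-reflexive (sym (0≤p⇒∣p∣≡p 0≤p))
  ... | inj₂ p≤0 = ≤-trans p≤0 (0≤∣p∣ p)

  tri : ∀ a b c → ∣ a - c ∣ ≤ ∣ a - b ∣ + ∣ b - c ∣
  tri a b c = begin
    ∣ a - c ∣               ≡⟨ cong ∣_∣ (solve 3 (λ a b c → a :- c := (a :- b) :+ (b :- c)) refl a b c) ⟩
    ∣ (a - b) + (b - c) ∣   ≤⟨ ∣p+q∣≤∣p∣+∣q∣ (a - b) (b - c) ⟩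
    ∣ a - b ∣ + ∣ b - c ∣   ∎

  dist-sym : ∀ a b → ∣ a - b ∣ ≡ ∣ b - a ∣
  dist-sym a b = trans (cong ∣_∣ (solve 2 (λ a b → a :- b := :- (b :- a)) refl a b)) (∣-p∣≡∣p∣ _)

  close-≥ : ∀ a b {ε} → ∣ a - b ∣ ≤ ε → a - ε ≤ b
  close-≥ a b {ε} le = begin
    a - ε         ≡⟨ solve 3 (λ a b e → a :- e := (a :- b) :+ (b :- e)) refl a b ε ⟩
    (a - b) + (b - ε) ≤⟨ +-monoˡ-≤ (b - ε) (≤-trans (p≤∣p∣ _) le) ⟩
    ε + (b - ε)   ≡⟨ solve 2 (λ b e → e :+ (b :- e) := b) refl b ε ⟩
    b             ∎

  abs-bound : ∀ a b {ε} → ∣ a - b ∣ ≤ ε → ∣ a ∣ ≤ ∣ b ∣ + ε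
  abs-bound a b {ε} le = begin
    ∣ a ∣               ≡⟨ cong ∣_∣ (solve 2 (λ a b → a := b :+ (a :- b)) refl a b) ⟩
    ∣ b + (a - b) ∣     ≤⟨ ∣p+q∣≤∣p∣+∣q∣ b (a - b) ⟩
    ∣ b ∣ + ∣ a - b ∣   ≤⟨ +-monoʳ-≤ ∣ b ∣ le ⟩
    ∣ b ∣ + ε           ∎

  -- To prove a sequence Cauchy it is enough to do so up to a constant factor.
  scaled : ∀ s K → 0ℚ < K →
           (∀ ε → 0ℚ < ε → ∃[ N ] (∀ m n → N ℕ.≤ m → N ℕ.≤ n → ∣ s m - s n ∣ ≤ K * ε)) →
           Cauchy s
  scaled s K 0<K p ε 0<ε with p (recip K * ε) (*-pos (recip-pos 0<K) 0<ε)
  ... | N , q = N , λ m n N≤m N≤n → ≤-trans (q m n N≤m N≤n) (≤-reflexive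
    (trans (solve 3 (λ k r e → k :* (r :* e) := k :* r :* e) refl K (recip K) ε)
    (trans (cong (_* ε) (recip-*ʳ 0<K)) (*-identityˡ ε))))

  recip-lipschitz : ∀ {δ p q} → 0ℚ < δ → δ ≤ p → δ ≤ q →
                    ∣ recip p - recip q ∣ ≤ recip δ * recip δ * ∣ p - q ∣
  recip-lipschitz {δ} {p} {q} 0<δ δ≤p δ≤q = begin
    ∣ u - v ∣                     ≡⟨ cong ∣_∣ (cong₂ (λ x y → x - y) (sym (*-identityʳ u)) (sym (*-identityʳ v))) ⟩
    ∣ u * 1ℚ - v * 1ℚ ∣           ≡⟨ cong ∣_∣ (cong₂ (λ x y → u * x - v * y) (sym (recip-*ʳ 0<q)) (sym (recip-*ʳ 0<p))) ⟩
    ∣ u * (q * v) - v * (p * u) ∣ ≡⟨ cong ∣_∣ (solve 4 (λ u v p q → u :* (q :* v) :- v :* (p :* u) := u :* v :* (q :- p)) refl u v p q) ⟩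
    ∣ u * v * (q - p) ∣           ≡⟨ ∣p*q∣≡∣p∣*∣q∣ (u * v) (q - p) ⟩
    ∣ u * v ∣ * ∣ q - p ∣         ≡⟨ cong₂ _*_ (0≤p⇒∣p∣≡p (*-nonneg 0≤u 0≤v)) (dist-sym q p) ⟩
    u * v * ∣ p - q ∣             ≤⟨ *-monoʳ-≤-nonNeg ∣ p - q ∣ ⦃ ∣-∣-nonNeg (p - q) ⦄
                                       (*-mono-≤ 0≤u (<⇒≤ (recip-pos 0<δ)) (recip-antimono 0<δ δ≤p) (recip-antimono 0<δ δ≤q)) ⟩
    recip δ * recip δ * ∣ p - q ∣ ∎
    where
    u = recip p
    v = recip q
    0<p = <-≤-trans 0<δ δ≤p
    0<q = <-≤-trans 0<δ δ≤q
    0≤u = <⇒≤ (recip-pos 0<p)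
    0≤v = <⇒≤ (recip-pos 0<q)

  fromℕ-unnorm : ∀ n → toℚᵘ (fromℕ n) ℚᵘ.≃ ℚᵘ.mkℚᵘ (+ n) 0
  fromℕ-unnorm n = toℚᵘ-fromℚᵘ (ℚᵘ.mkℚᵘ (+ n) 0)

  fromℕ-+ : ∀ m n → fromℕ (m ℕ.+ n) ≡ fromℕ m + fromℕ n
  fromℕ-+ m n = toℚᵘ-injective
    (ℚᵘₚ.≃-trans (fromℕ-unnorm (m ℕ.+ n))
    (ℚᵘₚ.≃-trans {j = ℚᵘ.mkℚᵘ (+ m) 0 ℚᵘ.+ ℚᵘ.mkℚᵘ (+ n) 0}
      (ℚᵘ.*≡* (cong (ℤ._* + 1) (sym (cong₂ ℤ._+_ (ℤₚ.*-identityʳ (+ m)) (ℤₚ.*-identityʳ (+ n))))))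
    (ℚᵘₚ.≃-sym (ℚᵘₚ.≃-trans (toℚᵘ-homo-+ (fromℕ m) (fromℕ n))
      (ℚᵘₚ.+-cong (fromℕ-unnorm m) (fromℕ-unnorm n))))))

  fromℕ-* : ∀ m n → fromℕ (m ℕ.* n) ≡ fromℕ m * fromℕ n
  fromℕ-* m n = toℚᵘ-injective
    (ℚᵘₚ.≃-trans (fromℕ-unnorm (m ℕ.* n))
    (ℚᵘₚ.≃-trans {j = ℚᵘ.mkℚᵘ (+ m) 0 ℚᵘ.* ℚᵘ.mkℚᵘ (+ n) 0}
      (ℚᵘ.*≡* (cong (ℤ._* + 1) (ℤₚ.pos-* m n)))
    (ℚᵘₚ.≃-sym (ℚᵘₚ.≃-trans (toℚᵘ-homo-* (fromℕ m) (fromℕ n))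
      (ℚᵘₚ.*-cong (fromℕ-unnorm m) (fromℕ-unnorm n))))))

  fromℕ-pos : ∀ n → 0ℚ < fromℕ (suc n)
  fromℕ-pos n = positive⁻¹ _ ⦃ normalize-pos (suc n) 1 ⦄

  fromℕ-nonneg : ∀ n → 0ℚ ≤ fromℕ n
  fromℕ-nonneg n = nonNegative⁻¹ _ ⦃ normalize-nonNeg n 1 ⦄

  fromℕ-suc : ∀ n → fromℕ (suc n) ≡ fromℕ n + 1ℚ
  fromℕ-suc n = trans (cong fromℕ (ℕₚ.+-comm 1 n)) (fromℕ-+ n 1)

  fromℕ-mono : ∀ {m n} → m ℕ.≤ n → fromℕ m ≤ fromℕ n
  fromℕ-mono {m} {n} m≤n = begin
    fromℕ m                     ≡⟨ sym (+-identityʳ _) ⟩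
    fromℕ m + 0ℚ                ≤⟨ +-monoʳ-≤ (fromℕ m) (fromℕ-nonneg (n ℕ.∸ m)) ⟩
    fromℕ m + fromℕ (n ℕ.∸ m)   ≡⟨ sym (fromℕ-+ m (n ℕ.∸ m)) ⟩
    fromℕ (m ℕ.+ (n ℕ.∸ m))     ≡⟨ cong fromℕ (ℕₚ.m+[n∸m]≡n m≤n) ⟩
    fromℕ n                     ∎

  -- If ε = a / d with a ≥ 1, then 1/(k+1) ≤ 1/d ≤ ε as soon as d ≤ k.
  archimedean : ∀ ε → 0ℚ < ε → ∃[ N ] (∀ k → N ℕ.≤ k → recip (fromℕ (suc k)) ≤ ε)
  archimedean ε 0<ε = N , bound
    where
    N = ↧ₙ ε
    ε*N : ∀ ε → 0ℚ < ε → 1ℚ ≤ ε * fromℕ (↧ₙ ε)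
    ε*N ε@(mkℚ (+ zero) d c) (*<* 0<) = contradiction 0< (ℤₚ.<-irrefl refl)
    ε*N (mkℚ ℤ.-[1+ a ] d c) (*<* ())
    ε*N ε@(mkℚ (+ suc a) d c) 0<ε = toℚᵘ-cancel-≤
      (ℚᵘₚ.≤-trans (ℚᵘ.*≤* le) (ℚᵘₚ.≤-reflexive (ℚᵘₚ.≃-sym
        (ℚᵘₚ.≃-trans (toℚᵘ-homo-* ε (fromℕ (suc d))) (ℚᵘₚ.*-congˡ {toℚᵘ ε} (fromℕ-unnorm (suc d)))))))
      where
      le : (+ 1) ℤ.* + (suc d ℕ.* 1) ℤ.≤ (+ suc a ℤ.* + suc d) ℤ.* + 1
      le = subst₂ ℤ._≤_ (trans (cong +_ (sym (ℕₚ.*-identityʳ (suc d)))) (sym (ℤₚ.*-identityˡ _)))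
             (trans (ℤₚ.pos-* (suc a) (suc d)) (sym (ℤₚ.*-identityʳ _)))
             (ℤ.+≤+ (ℕₚ.m≤m+n (suc d) (a ℕ.* suc d)))
    bound : ∀ k → N ℕ.≤ k → recip (fromℕ (suc k)) ≤ ε
    bound k N≤k = begin
      r                     ≡⟨ sym (*-identityˡ r) ⟩
      1ℚ * r                ≤⟨ *-monoʳ-≤-nonNeg r ⦃ nonNegative 0≤r ⦄ (ε*N ε 0<ε) ⟩
      ε * fromℕ N * r       ≤⟨ *-monoʳ-≤-nonNeg r ⦃ nonNegative 0≤r ⦄
                                 (*-monoˡ-≤-nonNeg ε ⦃ nonNegative (<⇒≤ 0<ε) ⦄ (fromℕ-mono (ℕₚ.m≤n⇒m≤1+n N≤k))) ⟩
      ε * fromℕ (suc k) * r ≡⟨ *-assoc ε _ r ⟩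
      ε * (fromℕ (suc k) * r) ≡⟨ cong (ε *_) (recip-*ʳ (fromℕ-pos k)) ⟩
      ε * 1ℚ                ≡⟨ *-identityʳ ε ⟩
      ε                     ∎
      where
      r = recip (fromℕ (suc k))
      0≤r = <⇒≤ (recip-pos (fromℕ-pos k))

  ∑<-split : ∀ m n f → ∑< (m ℕ.+ n) f ≡ ∑< m f + ∑< n (λ j → f (m ℕ.+ j))
  ∑<-split m zero    f = trans (cong (λ k → ∑< k f) (ℕₚ.+-identityʳ m)) (sym (+-identityʳ _))
  ∑<-split m (suc n) f = trans (cong (λ k → ∑< k f) (ℕₚ.+-suc m n))
    (trans (cong (_+ f (m ℕ.+ n)) (∑<-split m n f)) (+-assoc (∑< m f) _ _))

  -- A bound on |∑ᵢ f(i) - ∑ᵢ g(i)| from a bound on each block of m consecutive terms of f.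
  ∑<-blocks : ∀ n m f g c →
    (∀ i → i ℕ.< n → ∣ ∑< m (λ j → f (i ℕ.* m ℕ.+ j)) - g i ∣ ≤ c) →
    ∣ ∑< (n ℕ.* m) f - ∑< n g ∣ ≤ fromℕ n * c
  ∑<-blocks zero    m f g c p = ≤-reflexive (sym (*-zeroˡ c))
  ∑<-blocks (suc n) m f g c p = begin
    ∣ ∑< (m ℕ.+ n ℕ.* m) f - (∑< n g + g n) ∣
      ≡⟨ cong (λ z → ∣ z - (∑< n g + g n) ∣) (trans (cong (λ k → ∑< k f) (ℕₚ.+-comm m (n ℕ.* m))) (∑<-split (n ℕ.* m) m f)) ⟩
    ∣ (F + B) - (∑< n g + g n) ∣
      ≡⟨ cong ∣_∣ (solve 4 (λ a b c d → (a :+ b) :- (c :+ d) := (a :- c) :+ (b :- d)) refl F B (∑< n g) (g n)) ⟩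
    ∣ (F - ∑< n g) + (B - g n) ∣
      ≤⟨ ∣p+q∣≤∣p∣+∣q∣ (F - ∑< n g) (B - g n) ⟩
    ∣ F - ∑< n g ∣ + ∣ B - g n ∣
      ≤⟨ +-mono-≤ (∑<-blocks n m f g c (λ i i<n → p i (ℕₚ.m<n⇒m<1+n i<n))) (p n ℕₚ.≤-refl) ⟩
    fromℕ n * c + c
      ≡⟨ solve 2 (λ n c → n :* c :+ c := (n :+ con 1ℚ) :* c) refl (fromℕ n) c ⟩
    (fromℕ n + 1ℚ) * c
      ≡⟨ cong (_* c) (sym (fromℕ-suc n)) ⟩
    fromℕ (suc n) * c ∎
    where
    F = ∑< (n ℕ.* m) f
    B = ∑< m (λ j → f (n ℕ.* m ℕ.+ j))

  ∑<-close : ∀ n f g c → (∀ i → i ℕ.< n → ∣ f i - g i ∣ ≤ c) →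
    ∣ ∑< n f - ∑< n g ∣ ≤ fromℕ n * c
  ∑<-close zero    f g c p = ≤-reflexive (sym (*-zeroˡ c))
  ∑<-close (suc n) f g c p = begin
    ∣ (F + f n) - (G + g n) ∣
      ≡⟨ cong ∣_∣ (solve 4 (λ a b c d → (a :+ b) :- (c :+ d) := (a :- c) :+ (b :- d)) refl F (f n) G (g n)) ⟩
    ∣ (F - G) + (f n - g n) ∣
      ≤⟨ ∣p+q∣≤∣p∣+∣q∣ (F - G) (f n - g n) ⟩
    ∣ F - G ∣ + ∣ f n - g n ∣
      ≤⟨ +-mono-≤ (∑<-close n f g c (λ i i<n → p i (ℕₚ.m<n⇒m<1+n i<n))) (p n ℕₚ.≤-refl) ⟩
    fromℕ n * c + c
      ≡⟨ solve 2 (λ n c → n :* c :+ c := (n :+ con 1ℚ) :* c) refl (fromℕ n) c ⟩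
    (fromℕ n + 1ℚ) * c
      ≡⟨ cong (_* c) (sym (fromℕ-suc n)) ⟩
    fromℕ (suc n) * c ∎
    where
    F = ∑< n f
    G = ∑< n g

  ∑<-const : ∀ n c → ∑< n (λ _ → c) ≡ fromℕ n * c
  ∑<-const zero    c = sym (*-zeroˡ c)
  ∑<-const (suc n) c = trans (cong (_+ c) (∑<-const n c))
    (trans (solve 2 (λ n c → n :* c :+ c := (n :+ con 1ℚ) :* c) refl (fromℕ n) c)
           (cong (_* c) (sym (fromℕ-suc n))))

  -- The terms of the Riemann sums are h/D.
  term-close : ∀ {δ} h h′ D D′ → 0ℚ < δ → δ ≤ D → δ ≤ D′ →
    ∣ h * recip D - h′ * recip D′ ∣ ≤ ∣ h * D′ - h′ * D ∣ * (recip δ * recip δ)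
  term-close {δ} h h′ D D′ 0<δ δ≤D δ≤D′ = begin
    ∣ h * u - h′ * u′ ∣
      ≡⟨ cong ∣_∣ (cong₂ _-_ (sym (*-identityʳ (h * u))) (sym (*-identityʳ (h′ * u′)))) ⟩
    ∣ h * u * 1ℚ - h′ * u′ * 1ℚ ∣
      ≡⟨ cong ∣_∣ (cong₂ (λ a b → h * u * a - h′ * u′ * b) (sym (recip-*ʳ 0<D′)) (sym (recip-*ʳ 0<D))) ⟩
    ∣ h * u * (D′ * u′) - h′ * u′ * (D * u) ∣
      ≡⟨ cong ∣_∣ (solve 6 (λ h h′ D D′ u u′ → h :* u :* (D′ :* u′) :- h′ :* u′ :* (D :* u)
                     := (h :* D′ :- h′ :* D) :* (u :* u′)) refl h h′ D D′ u u′) ⟩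
    ∣ (h * D′ - h′ * D) * (u * u′) ∣
      ≡⟨ ∣p*q∣≡∣p∣*∣q∣ (h * D′ - h′ * D) (u * u′) ⟩
    ∣ h * D′ - h′ * D ∣ * ∣ u * u′ ∣
      ≡⟨ cong (∣ h * D′ - h′ * D ∣ *_) (0≤p⇒∣p∣≡p (*-nonneg (<⇒≤ (recip-pos 0<D)) (<⇒≤ (recip-pos 0<D′)))) ⟩
    ∣ h * D′ - h′ * D ∣ * (u * u′)
      ≤⟨ *-monoˡ-≤-nonNeg ∣ h * D′ - h′ * D ∣ ⦃ ∣-∣-nonNeg (h * D′ - h′ * D) ⦄
           (*-mono-≤ (<⇒≤ (recip-pos 0<D)) (<⇒≤ (recip-pos 0<δ)) (recip-antimono 0<δ δ≤D) (recip-antimono 0<δ δ≤D′)) ⟩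
    ∣ h * D′ - h′ * D ∣ * (recip δ * recip δ) ∎
    where
    u = recip D
    u′ = recip D′
    0<D = <-≤-trans 0<δ δ≤D
    0<D′ = <-≤-trans 0<δ δ≤D′

  step : ℕ → ℚ → ℚ
  step n q = (q - 1ℚ) * recip (fromℕ n)

  n*step : ∀ n q → fromℕ (suc n) * step (suc n) q ≡ q - 1ℚ
  n*step n q = trans (solve 3 (λ n a r → n :* (a :* r) := n :* r :* a) refl (fromℕ (suc n)) (q - 1ℚ) _)
    (trans (cong (_* (q - 1ℚ)) (recip-*ʳ (fromℕ-pos n))) (*-identityˡ _))

  -- The node 1 + i h is a convex combination of 1 and q.
  node-≥ : ∀ n i {δ q} → i ℕ.≤ suc n → δ ≤ 1ℚ → δ ≤ q → δ ≤ 1ℚ + fromℕ i * step (suc n) q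
  node-≥ n i {δ} {q} i≤n δ≤1 δ≤q = begin
    δ
      ≡⟨ solve 1 (λ d → d := d :* con 1ℚ) refl δ ⟩
    δ * 1ℚ
      ≡⟨ cong (δ *_) (sym (recip-*ʳ (fromℕ-pos n))) ⟩
    δ * (S * r)
      ≡⟨ solve 4 (λ d s r i → d :* (s :* r) := d :* ((s :- i) :* r) :+ d :* (i :* r)) refl δ S r I ⟩
    δ * ((S - I) * r) + δ * (I * r)
      ≤⟨ +-mono-≤ (*-monoʳ-≤-nonNeg _ ⦃ nonNegative (*-nonneg 0≤S-I 0≤r) ⦄ δ≤1)
                  (*-monoʳ-≤-nonNeg _ ⦃ nonNegative (*-nonneg (fromℕ-nonneg i) 0≤r) ⦄ δ≤q) ⟩
    1ℚ * ((S - I) * r) + q * (I * r)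
      ≡⟨ solve 4 (λ q s r i → con 1ℚ :* ((s :- i) :* r) :+ q :* (i :* r) := s :* r :+ i :* ((q :- con 1ℚ) :* r)) refl q S r I ⟩
    S * r + I * ((q - 1ℚ) * r)
      ≡⟨ cong (_+ I * ((q - 1ℚ) * r)) (recip-*ʳ (fromℕ-pos n)) ⟩
    1ℚ + I * ((q - 1ℚ) * r) ∎
    where
    S = fromℕ (suc n)
    I = fromℕ i
    r = recip S
    0≤r = <⇒≤ (recip-pos (fromℕ-pos n))
    0≤S-I : 0ℚ ≤ S - I
    0≤S-I = begin
      0ℚ    ≡⟨ sym (+-inverseʳ I) ⟩
      I - I ≤⟨ +-monoˡ-≤ (- I) (fromℕ-mono i≤n) ⟩
      S - I ∎

  riemann-lipschitz : ∀ n {δ p q} → 0ℚ < δ → δ ≤ 1ℚ → δ ≤ p → δ ≤ q →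
    ∣ riemann (suc n) p - riemann (suc n) q ∣ ≤ recip δ * recip δ * ∣ p - q ∣
  riemann-lipschitz n {δ} {p} {q} 0<δ δ≤1 δ≤p δ≤q = begin
    ∣ riemann (suc n) p - riemann (suc n) q ∣
      ≤⟨ ∑<-close (suc n) _ _ (∣ p - q ∣ * r * K) (λ i i<n → ≤-trans
           (term-close h h′ _ _ 0<δ (node-≥ n i (ℕₚ.<⇒≤ i<n) δ≤1 δ≤p) (node-≥ n i (ℕₚ.<⇒≤ i<n) δ≤1 δ≤q))
           (≤-reflexive (cong (_* K) (numerator i)))) ⟩
    N * (∣ p - q ∣ * r * K)
      ≡⟨ solve 4 (λ n r a k → n :* (a :* r :* k) := n :* r :* (k :* a)) refl N r ∣ p - q ∣ K ⟩
    N * r * (K * ∣ p - q ∣)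
      ≡⟨ trans (cong (_* (K * ∣ p - q ∣)) (recip-*ʳ (fromℕ-pos n))) (*-identityˡ _) ⟩
    K * ∣ p - q ∣ ∎
    where
    N = fromℕ (suc n)
    r = recip N
    K = recip δ * recip δ
    h = step (suc n) p
    h′ = step (suc n) q
    numerator : ∀ i → ∣ h * (1ℚ + fromℕ i * h′) - h′ * (1ℚ + fromℕ i * h) ∣ ≡ ∣ p - q ∣ * r
    numerator i = begin-equality
      ∣ h * (1ℚ + fromℕ i * h′) - h′ * (1ℚ + fromℕ i * h) ∣
        ≡⟨ cong ∣_∣ (solve 4 (λ p q r i → ((p :- con 1ℚ) :* r) :* (con 1ℚ :+ i :* ((q :- con 1ℚ) :* r))
                                       :- ((q :- con 1ℚ) :* r) :* (con 1ℚ :+ i :* ((p :- con 1ℚ) :* r))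
                                       := (p :- q) :* r) refl p q r (fromℕ i)) ⟩
      ∣ (p - q) * r ∣       ≡⟨ ∣p*q∣≡∣p∣*∣q∣ (p - q) r ⟩
      ∣ p - q ∣ * ∣ r ∣     ≡⟨ cong (∣ p - q ∣ *_) (0≤p⇒∣p∣≡p (<⇒≤ (recip-pos (fromℕ-pos n)))) ⟩
      ∣ p - q ∣ * r         ∎

  recip-unique : ∀ {a b} → 0ℚ < a → a * b ≡ 1ℚ → recip a ≡ b
  recip-unique {a} {b} 0<a ab≡1 = begin-equality
    recip a             ≡⟨ sym (*-identityʳ _) ⟩
    recip a * 1ℚ        ≡⟨ cong (recip a *_) (sym ab≡1) ⟩
    recip a * (a * b)   ≡⟨ solve 3 (λ r a b → r :* (a :* b) := a :* r :* b) refl (recip a) a b ⟩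
    a * recip a * b     ≡⟨ cong (_* b) (recip-*ʳ 0<a) ⟩
    1ℚ * b              ≡⟨ *-identityˡ b ⟩
    b                   ∎

  recip-fromℕ-* : ∀ n m → recip (fromℕ (suc n ℕ.* suc m)) ≡ recip (fromℕ (suc n)) * recip (fromℕ (suc m))
  recip-fromℕ-* n m = recip-unique (fromℕ-pos (m ℕ.+ n ℕ.* suc m)) (begin-equality
    fromℕ (suc n ℕ.* suc m) * (r * s)  ≡⟨ cong (_* (r * s)) (fromℕ-* (suc n) (suc m)) ⟩
    N * M * (r * s)                    ≡⟨ solve 4 (λ n m r s → n :* m :* (r :* s) := (n :* r) :* (m :* s)) refl N M r s ⟩
    (N * r) * (M * s)                  ≡⟨ cong₂ _*_ (recip-*ʳ (fromℕ-pos n)) (recip-*ʳ (fromℕ-pos m)) ⟩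
    1ℚ * 1ℚ                            ≡⟨ *-identityˡ 1ℚ ⟩
    1ℚ                                 ∎)
    where
    N = fromℕ (suc n)
    M = fromℕ (suc m)
    r = recip N
    s = recip M

  -- Refining the n-th partition into the nm-th moves each Riemann sum by O(1/n).
  riemann-refine : ∀ n m {δ q} → 0ℚ < δ → δ ≤ 1ℚ → δ ≤ q →
    ∣ riemann (suc n ℕ.* suc m) q - riemann (suc n) q ∣
      ≤ ∣ q - 1ℚ ∣ * ∣ q - 1ℚ ∣ * (recip δ * recip δ) * recip (fromℕ (suc n))
  riemann-refine n m {δ} {q} 0<δ δ≤1 δ≤q = begin
    ∣ riemann (suc n ℕ.* suc m) q - riemann (suc n) q ∣
      ≤⟨ ∑<-blocks (suc n) (suc m) _ _ (∣ h ∣ * ∣ h ∣ * K) block ⟩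
    N * (∣ h ∣ * ∣ h ∣ * K)
      ≡⟨ cong (λ z → N * (z * z * K)) ∣h∣ ⟩
    N * ((a * r) * (a * r) * K)
      ≡⟨ solve 4 (λ n a r k → n :* ((a :* r) :* (a :* r) :* k) := (n :* r) :* (a :* a :* k :* r)) refl N a r K ⟩
    (N * r) * (a * a * K * r)
      ≡⟨ trans (cong (_* (a * a * K * r)) (recip-*ʳ (fromℕ-pos n))) (*-identityˡ _) ⟩
    a * a * K * r ∎
    where
    N = fromℕ (suc n)
    M = fromℕ (suc m)
    r = recip N
    s = recip M
    K = recip δ * recip δ
    a = ∣ q - 1ℚ ∣
    h = step (suc n) q
    h′ = step (suc n ℕ.* suc m) q
    0≤K : 0ℚ ≤ K
    0≤K = *-nonneg (<⇒≤ (recip-pos 0<δ)) (<⇒≤ (recip-pos 0<δ))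
    ∣h∣ : ∣ h ∣ ≡ a * r
    ∣h∣ = trans (∣p*q∣≡∣p∣*∣q∣ (q - 1ℚ) r) (cong (a *_) (0≤p⇒∣p∣≡p (<⇒≤ (recip-pos (fromℕ-pos n)))))
    h≡ : h ≡ M * h′
    h≡ = sym (begin-equality
      M * ((q - 1ℚ) * recip (fromℕ (suc n ℕ.* suc m)))  ≡⟨ cong (λ z → M * ((q - 1ℚ) * z)) (recip-fromℕ-* n m) ⟩
      M * ((q - 1ℚ) * (r * s))  ≡⟨ solve 4 (λ m q r s → m :* (q :* (r :* s)) := (m :* s) :* (q :* r)) refl M (q - 1ℚ) r s ⟩
      (M * s) * h               ≡⟨ cong (_* h) (recip-*ʳ (fromℕ-pos m)) ⟩
      1ℚ * h                    ≡⟨ *-identityˡ h ⟩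
      h                         ∎)
    block : ∀ i → i ℕ.< suc n →
      ∣ ∑< (suc m) (λ j → h′ * recip (1ℚ + fromℕ (i ℕ.* suc m ℕ.+ j) * h′)) - h * recip (1ℚ + fromℕ i * h) ∣
        ≤ ∣ h ∣ * ∣ h ∣ * K
    block i i<n = begin
      ∣ ∑< (suc m) (λ j → h′ * recip (D′ j)) - h * recip D ∣
        ≡⟨ cong (λ z → ∣ ∑< (suc m) (λ j → h′ * recip (D′ j)) - z ∣)
             (sym (trans (∑<-const (suc m) (h′ * recip D)) (trans (sym (*-assoc M h′ _)) (cong (_* recip D) (sym h≡))))) ⟩
      ∣ ∑< (suc m) (λ j → h′ * recip (D′ j)) - ∑< (suc m) (λ _ → h′ * recip D) ∣
        ≤⟨ ∑<-close (suc m) _ _ (∣ h′ ∣ * ∣ h ∣ * K) (λ j j<m → ≤-trans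
             (term-close h′ h′ (D′ j) D 0<δ (node-≥ (m ℕ.+ n ℕ.* suc m) (i ℕ.* suc m ℕ.+ j) (index j<m) δ≤1 δ≤q)
               (node-≥ n i (ℕₚ.<⇒≤ i<n) δ≤1 δ≤q))
             (*-monoʳ-≤-nonNeg K ⦃ nonNegative 0≤K ⦄ (numerator j j<m))) ⟩
      M * (∣ h′ ∣ * ∣ h ∣ * K)
        ≡⟨ solve 4 (λ m h′ h k → m :* (h′ :* h :* k) := (m :* h′) :* h :* k) refl M ∣ h′ ∣ ∣ h ∣ K ⟩
      M * ∣ h′ ∣ * ∣ h ∣ * K
        ≡⟨ cong (λ z → z * ∣ h ∣ * K) M*∣h′∣ ⟩
      ∣ h ∣ * ∣ h ∣ * K ∎
      where
      D = 1ℚ + fromℕ i * h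
      D′ : ℕ → ℚ
      D′ j = 1ℚ + fromℕ (i ℕ.* suc m ℕ.+ j) * h′
      M*∣h′∣ : M * ∣ h′ ∣ ≡ ∣ h ∣
      M*∣h′∣ = trans (cong (_* ∣ h′ ∣) (sym (0≤p⇒∣p∣≡p (<⇒≤ (fromℕ-pos m)))))
                 (trans (sym (∣p*q∣≡∣p∣*∣q∣ M h′)) (cong ∣_∣ (sym h≡)))
      index : ∀ {j} → j ℕ.< suc m → i ℕ.* suc m ℕ.+ j ℕ.≤ suc n ℕ.* suc m
      index {j} j<m = ℕₚ.≤-trans (ℕₚ.+-monoʳ-≤ (i ℕ.* suc m) (ℕₚ.<⇒≤ j<m))
        (ℕₚ.≤-trans (ℕₚ.≤-reflexive (ℕₚ.+-comm (i ℕ.* suc m) (suc m))) (ℕₚ.*-monoˡ-≤ (suc m) i<n))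
      numerator : ∀ j → j ℕ.< suc m → ∣ h′ * D - h′ * D′ j ∣ ≤ ∣ h′ ∣ * ∣ h ∣
      numerator j j<m = begin
        ∣ h′ * D - h′ * D′ j ∣
          ≡⟨ cong ∣_∣ (cong₂ (λ x y → h′ * (1ℚ + I * x) - h′ * (1ℚ + y * h′)) h≡
               (trans (fromℕ-+ (i ℕ.* suc m) j) (cong (_+ J) (fromℕ-* i (suc m))))) ⟩
        ∣ h′ * (1ℚ + I * (M * h′)) - h′ * (1ℚ + (I * M + J) * h′) ∣
          ≡⟨ cong ∣_∣ (solve 4 (λ h i m j → h :* (con 1ℚ :+ i :* (m :* h)) :- h :* (con 1ℚ :+ (i :* m :+ j) :* h)
                                := :- (h :* (j :* h))) refl h′ I M J) ⟩
        ∣ - (h′ * (J * h′)) ∣     ≡⟨ ∣-p∣≡∣p∣ _ ⟩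
        ∣ h′ * (J * h′) ∣         ≡⟨ trans (∣p*q∣≡∣p∣*∣q∣ h′ _) (cong (∣ h′ ∣ *_) (∣p*q∣≡∣p∣*∣q∣ J h′)) ⟩
        ∣ h′ ∣ * (∣ J ∣ * ∣ h′ ∣) ≡⟨ cong (λ z → ∣ h′ ∣ * (z * ∣ h′ ∣)) (0≤p⇒∣p∣≡p (fromℕ-nonneg j)) ⟩
        ∣ h′ ∣ * (J * ∣ h′ ∣)     ≤⟨ *-monoˡ-≤-nonNeg ∣ h′ ∣ ⦃ ∣-∣-nonNeg h′ ⦄
                                       (*-monoʳ-≤-nonNeg ∣ h′ ∣ ⦃ ∣-∣-nonNeg h′ ⦄ (fromℕ-mono (ℕₚ.<⇒≤ j<m))) ⟩
        ∣ h′ ∣ * (M * ∣ h′ ∣)     ≡⟨ cong (∣ h′ ∣ *_) M*∣h′∣ ⟩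
        ∣ h′ ∣ * ∣ h ∣            ∎
        where
        I = fromℕ i
        J = fromℕ j

  riemann-close : ∀ m n {δ p q C ε} → 0ℚ < δ → δ ≤ 1ℚ → δ ≤ p → δ ≤ q →
    ∣ p - 1ℚ ∣ ≤ C → ∣ q - 1ℚ ∣ ≤ C → 0ℚ ≤ ε → recip (fromℕ (suc m)) ≤ ε → recip (fromℕ (suc n)) ≤ ε → ∣ p - q ∣ ≤ ε →
    ∣ riemann (suc m) p - riemann (suc n) q ∣ ≤ (C * C + 1ℚ + C * C) * (recip δ * recip δ) * ε
  riemann-close m n {δ} {p} {q} {C} {ε} 0<δ δ≤1 δ≤p δ≤q p≤C q≤C 0≤ε m≤ε n≤ε pq≤ε = begin
    ∣ A - D ∣
      ≤⟨ tri A B D ⟩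
    ∣ A - B ∣ + ∣ B - D ∣
      ≤⟨ +-monoʳ-≤ ∣ A - B ∣ (tri B B′ D) ⟩
    ∣ A - B ∣ + (∣ B - B′ ∣ + ∣ B′ - D ∣)
      ≤⟨ +-mono-≤
           (≤-trans (≤-reflexive (dist-sym A B)) (≤-trans (riemann-refine m n 0<δ δ≤1 δ≤p) (bound p p≤C m≤ε)))
           (+-mono-≤
             (≤-trans (riemann-lipschitz (n ℕ.+ m ℕ.* suc n) 0<δ δ≤1 δ≤p δ≤q) (*-monoˡ-≤-nonNeg K ⦃ nonNegative 0≤K ⦄ pq≤ε))
             (≤-trans (≤-reflexive (cong (λ k → ∣ riemann k q - D ∣) (ℕₚ.*-comm (suc m) (suc n))))
               (≤-trans (riemann-refine n m 0<δ δ≤1 δ≤q) (bound q q≤C n≤ε)))) ⟩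
    C * C * K * ε + (K * ε + C * C * K * ε)
      ≡⟨ solve 3 (λ c k e → c :* c :* k :* e :+ (k :* e :+ c :* c :* k :* e) := (c :* c :+ con 1ℚ :+ c :* c) :* k :* e) refl C K ε ⟩
    (C * C + 1ℚ + C * C) * K * ε ∎
    where
    A = riemann (suc m) p
    B = riemann (suc m ℕ.* suc n) p
    B′ = riemann (suc m ℕ.* suc n) q
    D = riemann (suc n) q
    K = recip δ * recip δ
    0≤K : 0ℚ ≤ K
    0≤K = *-nonneg (<⇒≤ (recip-pos 0<δ)) (<⇒≤ (recip-pos 0<δ))
    bound : ∀ x {r} → ∣ x - 1ℚ ∣ ≤ C → r ≤ ε → ∣ x - 1ℚ ∣ * ∣ x - 1ℚ ∣ * K * r ≤ C * C * K * ε
    bound x x≤C r≤ε = *-mono-≤ (*-nonneg (*-nonneg (0≤∣p∣ (x - 1ℚ)) (0≤∣p∣ (x - 1ℚ))) 0≤K) 0≤ε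
      (*-monoʳ-≤-nonNeg K ⦃ nonNegative 0≤K ⦄ (*-mono-≤ (0≤∣p∣ (x - 1ℚ)) (≤-trans (0≤∣p∣ (x - 1ℚ)) x≤C) x≤C x≤C)) r≤ε

------------------------------------------------------------------------
-- Real numbers: Cauchy sequences of rationals, up to _≈_

record ℝ : Set where
  no-eta-equality
  constructor mkℝ
  field
    seq    : ℕ → ℚ
    cauchy : Cauchy seq

open ℝ public

infix 4 _≈_ _≤_ _<_

_≈_ : ℝ → ℝ → Set
x ≈ y = ∀ ε → 0ℚ ℚ.< ε → Eventually (λ n → ℚ.∣ seq x n ℚ.- seq y n ∣ ℚ.≤ ε)

_≤_ : ℝ → ℝ → Set
x ≤ y = ∀ ε → 0ℚ ℚ.< ε → Eventually (λ n → seq x n ℚ.≤ seq y n ℚ.+ ε)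

_<_ : ℝ → ℝ → Set
x < y = ∃[ δ ] (0ℚ ℚ.< δ × Eventually (λ n → seq x n ℚ.+ δ ℚ.≤ seq y n))

fromℚ : ℚ → ℝ
fromℚ q = mkℝ (λ _ → q) λ ε 0<ε → 0 , λ _ _ _ _ →
  ℚₚ.≤-trans (ℚₚ.≤-reflexive (cong ℚ.∣_∣ (ℚₚ.+-inverseʳ q))) (ℚₚ.<⇒≤ 0<ε)

0ℝ 1ℝ : ℝ
0ℝ = fromℚ 0ℚ
1ℝ = fromℚ 1ℚ

module CauchyProofs where
  open import Data.Rational renaming (_≤_ to _≤ᵣ_; _<_ to _<ᵣ_)
  open ℚₚ
  open +-*-Solver
  open ≤-Reasoning
  open Estimates

  cauchy-+ : ∀ x y → Cauchy (λ n → seq x n + seq y n)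
  cauchy-+ x y = scaled (λ n → seq x n + seq y n) 2ℚ (positive⁻¹ 2ℚ) λ ε 0<ε →
    let M , p = cauchy x ε 0<ε
        N , q = cauchy y ε 0<ε
    in M ℕ.⊔ N , λ m n m≥ n≥ → begin
      ∣ (seq x m + seq y m) - (seq x n + seq y n) ∣
        ≡⟨ cong ∣_∣ (solve 4 (λ a b c d → (a :+ b) :- (c :+ d) := (a :- c) :+ (b :- d)) refl (seq x m) (seq y m) (seq x n) (seq y n)) ⟩
      ∣ (seq x m - seq x n) + (seq y m - seq y n) ∣
        ≤⟨ ∣p+q∣≤∣p∣+∣q∣ (seq x m - seq x n) (seq y m - seq y n) ⟩
      ∣ seq x m - seq x n ∣ + ∣ seq y m - seq y n ∣
        ≤⟨ +-mono-≤ (p m n (ℕₚ.m⊔n≤o⇒m≤o M N m≥) (ℕₚ.m⊔n≤o⇒m≤o M N n≥))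
                    (q m n (ℕₚ.m⊔n≤o⇒n≤o M N m≥) (ℕₚ.m⊔n≤o⇒n≤o M N n≥)) ⟩
      ε + ε
        ≡⟨ solve 1 (λ e → e :+ e := con 2ℚ :* e) refl ε ⟩
      2ℚ * ε ∎
    where 2ℚ = + 2 / 1

  cauchy-neg : ∀ x → Cauchy (λ n → - seq x n)
  cauchy-neg x ε 0<ε = let N , p = cauchy x ε 0<ε in N , λ m n m≥ n≥ → begin
    ∣ - seq x m - - seq x n ∣
      ≡⟨ cong ∣_∣ (solve 2 (λ a b → :- a :- :- b := :- (a :- b)) refl (seq x m) (seq x n)) ⟩
    ∣ - (seq x m - seq x n) ∣  ≡⟨ ∣-p∣≡∣p∣ (seq x m - seq x n) ⟩
    ∣ seq x m - seq x n ∣      ≤⟨ p m n m≥ n≥ ⟩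
    ε                          ∎

  bounded : ∀ x → ∃[ B ] (0ℚ <ᵣ B × Eventually (λ n → ∣ seq x n ∣ ≤ᵣ B))
  bounded x with cauchy x 1ℚ 0<1
  ... | N , p = ∣ seq x N ∣ + 1ℚ , +-mono-≤-< (0≤∣p∣ (seq x N)) 0<1 ,
    N , λ n n≥ → abs-bound (seq x n) (seq x N) (p n N n≥ ℕₚ.≤-refl)

  cauchy-* : ∀ x y → Cauchy (λ n → seq x n * seq y n)
  cauchy-* x y = let A , 0<A , K , a = bounded x ; B , 0<B , L , b = bounded y in scaled (λ n → seq x n * seq y n) (A + B) (+-pos 0<A 0<B) λ ε 0<ε →
    let M , p = cauchy x ε 0<ε
        N , q = cauchy y ε 0<ε
    in (K ℕ.⊔ L) ℕ.⊔ (M ℕ.⊔ N) , λ m n m≥ n≥ →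
      let m≥KL = ℕₚ.m⊔n≤o⇒m≤o (K ℕ.⊔ L) (M ℕ.⊔ N) m≥
          n≥KL = ℕₚ.m⊔n≤o⇒m≤o (K ℕ.⊔ L) (M ℕ.⊔ N) n≥
          m≥MN = ℕₚ.m⊔n≤o⇒n≤o (K ℕ.⊔ L) (M ℕ.⊔ N) m≥
          n≥MN = ℕₚ.m⊔n≤o⇒n≤o (K ℕ.⊔ L) (M ℕ.⊔ N) n≥
      in begin
      ∣ seq x m * seq y m - seq x n * seq y n ∣
        ≡⟨ cong ∣_∣ (solve 4 (λ a b c d → a :* b :- c :* d := a :* (b :- d) :+ d :* (a :- c)) refl (seq x m) (seq y m) (seq x n) (seq y n)) ⟩
      ∣ seq x m * (seq y m - seq y n) + seq y n * (seq x m - seq x n) ∣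
        ≤⟨ ∣p+q∣≤∣p∣+∣q∣ (seq x m * (seq y m - seq y n)) (seq y n * (seq x m - seq x n)) ⟩
      ∣ seq x m * (seq y m - seq y n) ∣ + ∣ seq y n * (seq x m - seq x n) ∣
        ≡⟨ cong₂ _+_ (∣p*q∣≡∣p∣*∣q∣ (seq x m) (seq y m - seq y n)) (∣p*q∣≡∣p∣*∣q∣ (seq y n) (seq x m - seq x n)) ⟩
      ∣ seq x m ∣ * ∣ seq y m - seq y n ∣ + ∣ seq y n ∣ * ∣ seq x m - seq x n ∣
        ≤⟨ +-mono-≤
             (*-mono-≤ (0≤∣p∣ (seq x m)) (<⇒≤ 0<ε) (a m (ℕₚ.m⊔n≤o⇒m≤o K L m≥KL))
               (q m n (ℕₚ.m⊔n≤o⇒n≤o M N m≥MN) (ℕₚ.m⊔n≤o⇒n≤o M N n≥MN)))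
             (*-mono-≤ (0≤∣p∣ (seq y n)) (<⇒≤ 0<ε) (b n (ℕₚ.m⊔n≤o⇒n≤o K L n≥KL))
               (p m n (ℕₚ.m⊔n≤o⇒m≤o M N m≥MN) (ℕₚ.m⊔n≤o⇒m≤o M N n≥MN))) ⟩
      A * ε + B * ε
        ≡⟨ sym (*-distribʳ-+ ε A B) ⟩
      (A + B) * ε ∎

  bounded-below : ∀ {x} → 0ℝ < x → ∃[ δ ] (0ℚ <ᵣ δ × Eventually (λ n → δ ≤ᵣ seq x n))
  bounded-below {x} (δ , 0<δ , N , p) =
    δ , 0<δ , N , λ n n≥ → subst (_≤ᵣ seq x n) (+-identityˡ δ) (p n n≥)

  cauchy-recip : ∀ x → 0ℝ < x → Cauchy (λ n → recip (seq x n))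
  cauchy-recip x 0<x =
    let δ , 0<δ , M , b = bounded-below {x} 0<x
        0<K = *-pos (recip-pos 0<δ) (recip-pos 0<δ)
    in scaled (λ n → recip (seq x n)) (recip δ * recip δ) 0<K λ ε 0<ε →
    let N , p = cauchy x ε 0<ε
    in M ℕ.⊔ N , λ m n m≥ n≥ → ≤-trans
      (recip-lipschitz 0<δ (b m (ℕₚ.m⊔n≤o⇒m≤o M N m≥)) (b n (ℕₚ.m⊔n≤o⇒m≤o M N n≥)))
      (*-monoˡ-≤-nonNeg (recip δ * recip δ) ⦃ nonNegative (<⇒≤ 0<K) ⦄
        (p m n (ℕₚ.m⊔n≤o⇒n≤o M N m≥) (ℕₚ.m⊔n≤o⇒n≤o M N n≥)))

  cauchy-ln : ∀ x → 0ℝ < x → Cauchy (λ n → riemann (suc n) (seq x n))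
  cauchy-ln x 0<x = scaled (λ n → riemann (suc n) (seq x n)) K 0<K λ ε 0<ε →
    let N , p = cauchy x ε 0<ε
        R , r = archimedean ε 0<ε
    in (M ℕ.⊔ L) ℕ.⊔ (N ℕ.⊔ R) , λ m n m≥ n≥ →
      let m≥ML = ℕₚ.m⊔n≤o⇒m≤o (M ℕ.⊔ L) (N ℕ.⊔ R) m≥
          n≥ML = ℕₚ.m⊔n≤o⇒m≤o (M ℕ.⊔ L) (N ℕ.⊔ R) n≥
          m≥NR = ℕₚ.m⊔n≤o⇒n≤o (M ℕ.⊔ L) (N ℕ.⊔ R) m≥
          n≥NR = ℕₚ.m⊔n≤o⇒n≤o (M ℕ.⊔ L) (N ℕ.⊔ R) n≥
      in riemann-close m n 0<δ (p⊓q≤q δ₀ 1ℚ)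
        (≤-trans (p⊓q≤p δ₀ 1ℚ) (b m (ℕₚ.m⊔n≤o⇒m≤o M L m≥ML)))
        (≤-trans (p⊓q≤p δ₀ 1ℚ) (b n (ℕₚ.m⊔n≤o⇒m≤o M L n≥ML)))
        (≤C m (ℕₚ.m⊔n≤o⇒n≤o M L m≥ML)) (≤C n (ℕₚ.m⊔n≤o⇒n≤o M L n≥ML))
        (<⇒≤ 0<ε)
        (r m (ℕₚ.m⊔n≤o⇒n≤o N R m≥NR)) (r n (ℕₚ.m⊔n≤o⇒n≤o N R n≥NR))
        (p m n (ℕₚ.m⊔n≤o⇒m≤o N R m≥NR) (ℕₚ.m⊔n≤o⇒m≤o N R n≥NR))
    where
    x-below = bounded-below {x} 0<x
    x-above = bounded x
    δ₀ = proj₁ x-below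
    M  = proj₁ (proj₂ (proj₂ x-below))
    b  = proj₂ (proj₂ (proj₂ x-below))
    B  = proj₁ x-above
    L  = proj₁ (proj₂ (proj₂ x-above))
    a  = proj₂ (proj₂ (proj₂ x-above))
    δ = δ₀ ⊓ 1ℚ
    C = B + 1ℚ
    K = (C * C + 1ℚ + C * C) * (recip δ * recip δ)
    0<δ : 0ℚ <ᵣ δ
    0<δ with ⊓-sel δ₀ 1ℚ
    ... | inj₁ e = subst (0ℚ <ᵣ_) (sym e) (proj₁ (proj₂ x-below))
    ... | inj₂ e = subst (0ℚ <ᵣ_) (sym e) 0<1
    0<C : 0ℚ <ᵣ C
    0<C = +-pos (proj₁ (proj₂ x-above)) 0<1
    0<K : 0ℚ <ᵣ K
    0<K = *-pos (+-pos (+-pos (*-pos 0<C 0<C) 0<1) (*-pos 0<C 0<C)) (*-pos (recip-pos 0<δ) (recip-pos 0<δ))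
    ≤C : ∀ n → L ℕ.≤ n → ∣ seq x n - 1ℚ ∣ ≤ᵣ C
    ≤C n n≥ = ≤-trans (∣p-q∣≤∣p∣+∣q∣ (seq x n) 1ℚ) (+-monoˡ-≤ 1ℚ (a n n≥))

open CauchyProofs using (cauchy-+; cauchy-neg; cauchy-*; cauchy-recip; cauchy-ln; bounded; bounded-below)

infixl 6 _+_ _-_
infixl 7 _*_
infix  8 -_

_+_ : ℝ → ℝ → ℝ
x + y = mkℝ (λ n → seq x n ℚ.+ seq y n) (cauchy-+ x y)

-_ : ℝ → ℝ
- x = mkℝ (λ n → ℚ.- seq x n) (cauchy-neg x)

_-_ : ℝ → ℝ → ℝ
x - y = x + - y

_*_ : ℝ → ℝ → ℝ
x * y = mkℝ (λ n → seq x n ℚ.* seq y n) (cauchy-* x y)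

inverse : (x : ℝ) → 0ℝ < x → ℝ
inverse x 0<x = mkℝ (λ n → recip (seq x n)) (cauchy-recip x 0<x)

divide : (x y : ℝ) → 0ℝ < y → ℝ
divide x y 0<y = x * inverse y 0<y

syntax divide x y 0<y = x / y [ 0<y ]

-- ln x = ∫₁ˣ dt/t, as the limit of the Riemann sums.
ln : (x : ℝ) → 0ℝ < x → ℝ
ln x 0<x = mkℝ (λ n → riemann (suc n) (seq x n)) (cauchy-ln x 0<x)

divide-pos : ∀ x y → 0ℝ < x → (0<y : 0ℝ < y) → 0ℝ < x / y [ 0<y ]
divide-pos x y 0<x 0<y =
  let δ , 0<δ , K , a = bounded-below {x} 0<x
      η , 0<η , L , c = bounded-below {y} 0<y
      B , 0<B , M , b = bounded y
  in δ ℚ.* recip B , *-pos 0<δ (recip-pos 0<B) , (K ℕ.⊔ L) ℕ.⊔ M , λ n n≥ →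
    let n≥KL = ℕₚ.m⊔n≤o⇒m≤o (K ℕ.⊔ L) M n≥
        η≤y = c n (ℕₚ.m⊔n≤o⇒n≤o K L n≥KL)
        δ≤x = a n (ℕₚ.m⊔n≤o⇒m≤o K L n≥KL)
        y≤B = ℚₚ.≤-trans (p≤∣p∣ (seq y n)) (b n (ℕₚ.m⊔n≤o⇒n≤o (K ℕ.⊔ L) M n≥))
        0<yₙ = ℚₚ.<-≤-trans 0<η η≤y
    in ℚₚ.≤-trans (ℚₚ.≤-reflexive (ℚₚ.+-identityˡ (δ ℚ.* recip B)))
         (*-mono-≤ (ℚₚ.<⇒≤ 0<δ) (ℚₚ.<⇒≤ (recip-pos 0<yₙ))
           δ≤x (recip-antimono 0<yₙ y≤B))
  where open Estimates

------------------------------------------------------------------------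
-- Computable functions

-- μ-recursive functions; prec f g is primitive recursion on the first
-- argument and min f is unbounded search on the first argument of f.
data Rec : ℕ → Set where
  zeroᵣ : ∀ {n} → Rec n
  sucᵣ  : Rec 1
  proj  : ∀ {n} → Fin n → Rec n
  comp  : ∀ {m n} → Rec m → Vec (Rec n) m → Rec n
  prec  : ∀ {n} → Rec n → Rec (2 ℕ.+ n) → Rec (1 ℕ.+ n)
  min   : ∀ {n} → Rec (1 ℕ.+ n) → Rec n

infix 4 _⟨_⟩⇓_

data _⟨_⟩⇓_ : ∀ {n} → Rec n → Vec ℕ n → ℕ → Set where
  zero⇓ : ∀ {n} {xs : Vec ℕ n} → zeroᵣ ⟨ xs ⟩⇓ 0
  suc⇓  : ∀ {x} → sucᵣ ⟨ x ∷ [] ⟩⇓ suc x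
  proj⇓ : ∀ {n} {i : Fin n} {xs} → proj i ⟨ xs ⟩⇓ Vec.lookup xs i
  comp⇓ : ∀ {m n} {f : Rec m} {gs : Vec (Rec n) m} {xs ys z} →
          Pointwise (λ g y → g ⟨ xs ⟩⇓ y) gs ys → f ⟨ ys ⟩⇓ z → comp f gs ⟨ xs ⟩⇓ z
  prec⇓-zero : ∀ {n} {f : Rec n} {g xs y} → f ⟨ xs ⟩⇓ y → prec f g ⟨ 0 ∷ xs ⟩⇓ y
  prec⇓-suc  : ∀ {n} {f : Rec n} {g xs k y z} → prec f g ⟨ k ∷ xs ⟩⇓ y →
               g ⟨ k ∷ y ∷ xs ⟩⇓ z → prec f g ⟨ suc k ∷ xs ⟩⇓ z
  min⇓  : ∀ {n} {f : Rec (1 ℕ.+ n)} {xs k} → f ⟨ k ∷ xs ⟩⇓ 0 →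
          (∀ i → i ℕ.< k → ∃[ v ] (f ⟨ i ∷ xs ⟩⇓ suc v)) → min f ⟨ xs ⟩⇓ k

String : Set
String = List Bool

-- A bijection between strings and natural numbers.
code : String → ℕ
code []          = 0
code (false ∷ σ) = 1 ℕ.+ 2 ℕ.* code σ
code (true  ∷ σ) = 2 ℕ.+ 2 ℕ.* code σ

-- From σ and k, three recursive functions compute a rational (a - b)/(1 + c)
-- within 1/(1 + k) of f(σ).
IsComputable : (String → ℝ) → Set
IsComputable f = Σ (Rec 2) λ A → Σ (Rec 2) λ B → Σ (Rec 2) λ C → ∀ σ k →
  let args = code σ ∷ k ∷ []
      ε    = + 1 ℚ./ suc k
  in ∃[ a ] ∃[ b ] ∃[ c ] (A ⟨ args ⟩⇓ a × B ⟨ args ⟩⇓ b × C ⟨ args ⟩⇓ c ×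
       fromℚ ((a ⊖ b) ℚ./ suc c ℚ.- ε) ≤ f σ × f σ ≤ fromℚ ((a ⊖ b) ℚ./ suc c ℚ.+ ε))

------------------------------------------------------------------------
-- Measures on Cantor space

-- A measure is identified with its values on the cylinders [σ].
record ProbabilityMeasure : Set where
  field
    ν⟨_⟩     : String → ℝ
    nonneg   : ∀ σ → 0ℝ ≤ ν⟨ σ ⟩
    total    : ν⟨ [] ⟩ ≈ 1ℝ
    additive : ∀ σ → ν⟨ σ ⟩ ≈ ν⟨ σ ∷ʳ false ⟩ + ν⟨ σ ∷ʳ true ⟩

open ProbabilityMeasure public using () renaming (ν⟨_⟩ to _⟨_⟩)

FullSupport : ProbabilityMeasure → Set
FullSupport ν = ∀ σ → 0ℝ < ν ⟨ σ ⟩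

_↾_ : (ℕ → Bool) → ℕ → String
ω ↾ n = applyUpTo ω n

-- [σ] ∩ [τ] is a cylinder (just) or empty (nothing).
_∩_ : String → String → Maybe String
[]          ∩ τ           = just τ
(b ∷ σ)     ∩ []          = just (b ∷ σ)
(false ∷ σ) ∩ (false ∷ τ) = Maybe.map (false ∷_) (σ ∩ τ)
(true  ∷ σ) ∩ (true  ∷ τ) = Maybe.map (true ∷_) (σ ∩ τ)
(false ∷ σ) ∩ (true  ∷ τ) = nothing
(true  ∷ σ) ∩ (false ∷ τ) = nothing

-- ν(σ ∣ τ) = ν([σ] ∩ [τ]) / ν(τ)
conditional : (ν : ProbabilityMeasure) → FullSupport ν → String → String → ℝ
conditional ν ν>0 τ σ = Maybe.maybe (ν ⟨_⟩) 0ℝ (σ ∩ τ) / ν ⟨ τ ⟩ [ ν>0 τ ]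

------------------------------------------------------------------------
-- Divergence on 𝓕ₘ

-- 𝓕ₘ is the finite σ-algebra with atoms [σ], |σ| = m: its events are sets
-- of atoms, 𝓕ₘ-measurable functions are functions of the atom, and measures
-- on it are given by their values on the atoms.
Atom : ℕ → Set
Atom m = Vec Bool m

Event : ℕ → Set
Event m = Atom m → Bool

∑ : ∀ {m} → (Atom m → ℝ) → ℝ
∑ {zero}  f = f []
∑ {suc m} f = ∑ {m} (λ σ → f (false ∷ σ)) + ∑ {m} (λ σ → f (true ∷ σ))

restrict : ∀ m → (String → ℝ) → Atom m → ℝ
restrict m ν σ = ν (toList σ)

∫ : ∀ {m} → Event m → (Atom m → ℝ) → (Atom m → ℝ) → ℝ
∫ E f P = ∑ λ σ → if E σ then f σ * P σ else 0ℝ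

measure : ∀ {m} → (Atom m → ℝ) → Event m → ℝ
measure P E = ∫ E (λ _ → 1ℝ) P

𝔼 : ∀ {m} → (Atom m → ℝ) → (Atom m → ℝ) → ℝ
𝔼 P g = ∫ (λ _ → true) g P

_≪_ : ∀ {m} → (Atom m → ℝ) → (Atom m → ℝ) → Set
_≪_ {m} P Q = (E : Event m) → measure Q E ≈ 0ℝ → measure P E ≈ 0ℝ

-- f = dP/dQ
IsRadonNikodym : ∀ {m} → (P Q f : Atom m → ℝ) → Set
IsRadonNikodym {m} P Q f =
  (∀ σ → 0ℝ ≤ f σ) × ((E : Event m) → measure P E ≈ ∫ E f Q)

-- g = ln f holds P-almost everywhere.  (A density dP/dQ may vanish, but only
-- on a P-null event, where the values of g do not affect 𝔼 P g.)
IsLog : ∀ {m} → (P f g : Atom m → ℝ) → Set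
IsLog P f g = ∃[ E ] (measure P (not ∘ E) ≈ 0ℝ ×
  (∀ σ → E σ ≡ true → Σ (0ℝ < f σ) λ 0<f → g σ ≈ ln (f σ) 0<f))

-- D(P ∣ Q) = d
IsDivergence : ∀ {m} → (P Q : Atom m → ℝ) → ℝ → Set
IsDivergence P Q d = P ≪ Q × ∃[ f ] ∃[ g ]
  (IsRadonNikodym P Q f × IsLog P f g × d ≈ 𝔼 P g)

-- The value of D_{𝓕ₙ₊₁}(ν ∣ μ)(ω) is d.
DivergenceAt : (ν μ : ProbabilityMeasure) → FullSupport ν → FullSupport μ →
               ℕ → (ℕ → Bool) → ℝ → Set
DivergenceAt ν μ ν>0 μ>0 n ω d = IsDivergence
  (restrict (suc n) (conditional ν ν>0 (ω ↾ n)))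
  (restrict (suc n) (conditional μ μ>0 (ω ↾ n)))
  d

------------------------------------------------------------------------
-- Martingales and the Doob decomposition

-- M(σ0) ν(σ0 ∣ σ) + M(σ1) ν(σ1 ∣ σ)
conditionalMean : (ν : ProbabilityMeasure) → FullSupport ν → (String → ℝ) → String → ℝ
conditionalMean ν ν>0 M σ = term false + term true
  where
  term : Bool → ℝ
  term ι = M (σ ∷ʳ ι) * (ν ⟨ σ ∷ʳ ι ⟩ / ν ⟨ σ ⟩ [ ν>0 σ ])

IsMartingale : (ν : ProbabilityMeasure) → FullSupport ν → (String → ℝ) → Set
IsMartingale ν ν>0 M = ∀ σ → M σ ≈ conditionalMean ν ν>0 M σ

record IsDoobDecomposition (ν : ProbabilityMeasure) (ν>0 : FullSupport ν)
                           (L N A : String → ℝ) : Set where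
  field
    martingale    : IsMartingale ν ν>0 N
    N-computable  : IsComputable N
    A-computable  : IsComputable A
    A-nonneg      : ∀ σ → 0ℝ ≤ A σ
    A-increasing  : ∀ σ τ → A σ ≤ A (σ ++ τ)
    decomposition : ∀ σ → L σ ≈ N σ + A σ
    initial       : N [] ≈ L []
    increment     : ∀ τ ι → A (τ ∷ʳ ι) - A τ ≈ conditionalMean ν ν>0 L τ - L τ

-- L(τ) = - ln (μ(τ) / ν(τ))
negLogRatio : (ν μ : ProbabilityMeasure) → FullSupport ν → FullSupport μ → String → ℝ
negLogRatio ν μ ν>0 μ>0 τ =
  - ln (μ ⟨ τ ⟩ / ν ⟨ τ ⟩ [ ν>0 τ ]) (divide-pos (μ ⟨ τ ⟩) (ν ⟨ τ ⟩) (μ>0 τ) (ν>0 τ))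

{-# OPTIONS --safe #-}

-- Let τ = ω ↾ n.  A density of ν(· ∣ τ) with respect to μ(· ∣ τ) on the atoms is
-- f(σ) = (μ(τ)/ν(τ)) / (μ(σ)/ν(σ)), so ln f(σ) = L(σ) - L(τ) by additivity of the
-- logarithm.  Only the two children of τ carry mass, hence the divergence is
-- L(τ0) ν(τ0 ∣ τ) + L(τ1) ν(τ1 ∣ τ) - L(τ), the increment of the predictable
-- process.  Any other density and logarithm agree with f and ln f on the atoms of
-- positive mass, so the value of the divergence is unique.
--
-- For ln (p q) = ln p + ln q on Riemann sums Rₙ, the estimate
-- Rₙ(b) - Rₙ(a) = (b - a)/a + O(|b - a| (|b - a| + 1/n)) is summed over the
-- consecutive points aᵢ = p (1 + i (q - 1)/n) from p to p q; the main terms add up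
-- to Rₙ(q) and the total error is O(1/n).
module Submission where

open import Data.Bool using (Bool; true; false; not; if_then_else_)
open import Data.Empty using (⊥-elim)
open import Data.List using ([]; _∷_; _∷ʳ_; length)
open import Data.List.Properties using (applyUpTo-∷ʳ; length-applyUpTo)
open import Data.Maybe as Maybe using (just; nothing; maybe′)
open import Data.Nat as ℕ using (ℕ; suc; zero; s≤s)
import Data.Nat.Properties as ℕₚ
open import Data.Product using (Σ; _×_; _,_; ∃-syntax)
open import Data.Rational as ℚ using (ℚ; 0ℚ; 1ℚ)
import Data.Rational.Properties as ℚₚ
open import Data.Rational.Solver using (module +-*-Solver)
open import Data.Sum as Sum using (_⊎_; inj₁; inj₂)
open import Data.Vec using ([]; _∷_; toList)
open import Function using (_⇔_; mk⇔; _∘_; Equivalence)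
open import Relation.Binary.Bundles using (Setoid)
open import Relation.Binary.PropositionalEquality
  using (_≡_; refl; sym; trans; cong; cong₂; subst)
import Relation.Binary.Reasoning.Setoid as SetoidReasoning
open import Relation.Nullary using (¬_)

-- Riemann sums for the logarithm: first-order expansion and approximate additivity.

module RiemannSums where
  open import Defs using (module Estimates; fromℕ; recip; riemann; ∑<)
  open import Data.Rational
  open ℚₚ
  open +-*-Solver
  open Estimates
  open ≤-Reasoning

  -- The partition points of `riemann (suc n) q`, whose `i`-th summand is the step divided by
  -- `node n q i`.
  node : ℕ → ℚ → ℕ → ℚ
  node n q i = 1ℚ + fromℕ i * step (suc n) q

  node-end : ∀ n q → node n q (suc n) ≡ q
  node-end n q = trans (cong (1ℚ +_) (n*step n q)) (solve 1 (λ q → con 1ℚ :+ (q :- con 1ℚ) := q) refl q)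

  fraction≤1 : ∀ n {i} → i ℕ.≤ suc n → fromℕ i * recip (fromℕ (suc n)) ≤ 1ℚ
  fraction≤1 n i≤n = ≤-trans
    (*-monoʳ-≤-nonNeg (recip (fromℕ (suc n))) ⦃ nonNegative (<⇒≤ (recip-pos (fromℕ-pos n))) ⦄ (fromℕ-mono i≤n))
    (≤-reflexive (recip-*ʳ (fromℕ-pos n)))

  ∣step∣ : ∀ n q → ∣ step (suc n) q ∣ ≡ ∣ q - 1ℚ ∣ * recip (fromℕ (suc n))
  ∣step∣ n q = trans (∣p*q∣≡∣p∣*∣q∣ (q - 1ℚ) r) (cong (∣ q - 1ℚ ∣ *_) (0≤p⇒∣p∣≡p (<⇒≤ (recip-pos (fromℕ-pos n)))))
    where r = recip (fromℕ (suc n))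

  -- A first-order expansion of the logarithm at `a`. The linear term `(b - a) * recip a` is
  -- distributed over the summands as `(b - a) * (r * (u i * u (suc i)))`; each summand then has an
  -- error of second order, and there are `suc n` of them, each with a factor `r`.
  riemann-step : ∀ n {δ a b} → 0ℚ < δ → δ ≤ 1ℚ → δ ≤ a → δ ≤ b →
    ∣ riemann (suc n) b - (riemann (suc n) a + (b - a) * recip a) ∣
      ≤ ∣ b - a ∣ * (∣ b - a ∣ + ∣ a - 1ℚ ∣ * recip (fromℕ (suc n))) * (recip δ * (recip δ * recip δ))
  riemann-step n {δ} {a} {b} 0<δ δ≤1 δ≤a δ≤b = begin
    ∣ riemann (suc n) b - (riemann (suc n) a + (b - a) * recip a) ∣
      ≡⟨ cong (λ z → ∣ riemann (suc n) b - z ∣) (sym ∑g) ⟩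
    ∣ ∑< (suc n) f - ∑< (suc n) g ∣
      ≤⟨ ∑<-close (suc n) f g c f≈g ⟩
    N * c
      ≡⟨ solve 5 (λ n r d e k → n :* (d :* r :* e :* k) := (n :* r) :* (d :* e :* k)) refl N r ∣ b - a ∣ e K ⟩
    N * r * (∣ b - a ∣ * e * K)
      ≡⟨ trans (cong (_* (∣ b - a ∣ * e * K)) (recip-*ʳ (fromℕ-pos n))) (*-identityˡ _) ⟩
    ∣ b - a ∣ * e * K ∎
    where
    N = fromℕ (suc n)
    r = recip N
    κ = recip δ
    K = κ * (κ * κ)
    -- A bound for the distance between `D′ i` and `D (suc i)`: the first term comes from moving the
    -- endpoint, the second from shifting the index by one.
    e = ∣ b - a ∣ + ∣ a - 1ℚ ∣ * r
    c = ∣ b - a ∣ * r * e * K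
    h = step (suc n) a
    h′ = step (suc n) b
    D = node n a
    D′ = node n b
    u : ℕ → ℚ
    u i = recip (D i)
    f g : ℕ → ℚ
    f i = h′ * recip (D′ i)
    g i = h * u i + (b - a) * (r * (u i * u (suc i)))
    0≤r = <⇒≤ (recip-pos (fromℕ-pos n))
    0≤κ = <⇒≤ (recip-pos 0<δ)

    δ≤D : ∀ {i} → i ℕ.≤ suc n → δ ≤ D i
    δ≤D {i} i≤n = node-≥ n i i≤n δ≤1 δ≤a
    δ≤D′ : ∀ {i} → i ℕ.≤ suc n → δ ≤ D′ i
    δ≤D′ {i} i≤n = node-≥ n i i≤n δ≤1 δ≤b

    -- ∑ r/(Dᵢ Dᵢ₊₁) telescopes, which replaces ∫₀¹ ds/(1 + s(a - 1))² = 1/a.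
    telescope : ∀ k → k ℕ.≤ suc n → ∑< k g ≡ ∑< k (λ i → h * u i) + (b - a) * (fromℕ k * r * u k)
    telescope zero    _   = solve 3 (λ d r u → con 0ℚ := con 0ℚ :+ d :* (con 0ℚ :* r :* u)) refl (b - a) r (u 0)
    telescope (suc k) k<n = begin-equality
      ∑< k g + g k
        ≡⟨ cong (_+ g k) (telescope k (ℕₚ.<⇒≤ k<n)) ⟩
      (S + (b - a) * (fromℕ k * r * u k)) + (h * u k + (b - a) * (r * (u k * v)))
        ≡⟨ solve 7 (λ s d k r u v h → (s :+ d :* (k :* r :* u)) :+ (h :* u :+ d :* (r :* (u :* v)))
                     := (s :+ h :* u) :+ d :* (k :* r :* u :+ r :* (u :* v)))
             refl S (b - a) (fromℕ k) r (u k) v h ⟩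
      (S + h * u k) + (b - a) * (fromℕ k * r * u k + r * (u k * v))
        ≡⟨ cong (λ z → (S + h * u k) + (b - a) * z) fractions ⟩
      (S + h * u k) + (b - a) * (fromℕ (suc k) * r * v) ∎
      where
      S = ∑< k (λ i → h * u i)
      v = u (suc k)
      uD≡1 = recip-*ʳ (<-≤-trans 0<δ (δ≤D (ℕₚ.<⇒≤ k<n)))
      vD≡1 = recip-*ʳ (<-≤-trans 0<δ (δ≤D k<n))
      -- Over the common denominator `D k * D (suc k)` this is the identity `k (1 + (k + 1) h) + 1 =
      -- (k + 1) (1 + k h)`.
      fractions : fromℕ k * r * u k + r * (u k * v) ≡ fromℕ (suc k) * r * v
      fractions = begin-equality
        fromℕ k * r * u k + r * (u k * v)
          ≡⟨ cong (λ z → z + r * (u k * v)) (sym (*-identityʳ (fromℕ k * r * u k))) ⟩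
        fromℕ k * r * u k * 1ℚ + r * (u k * v)
          ≡⟨ cong (λ z → fromℕ k * r * u k * z + r * (u k * v)) (trans (sym vD≡1) (cong (λ z → (1ℚ + z * h) * v) (fromℕ-suc k))) ⟩
        fromℕ k * r * u k * ((1ℚ + (fromℕ k + 1ℚ) * h) * v) + r * (u k * v)
          ≡⟨ solve 5 (λ k r u v h → k :* r :* u :* ((con 1ℚ :+ (k :+ con 1ℚ) :* h) :* v) :+ r :* (u :* v)
                       := (k :+ con 1ℚ) :* r :* v :* ((con 1ℚ :+ k :* h) :* u)) refl (fromℕ k) r (u k) v h ⟩
        (fromℕ k + 1ℚ) * r * v * ((1ℚ + fromℕ k * h) * u k)
          ≡⟨ cong₂ (λ y z → y * r * v * z) (sym (fromℕ-suc k)) uD≡1 ⟩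
        fromℕ (suc k) * r * v * 1ℚ
          ≡⟨ *-identityʳ _ ⟩
        fromℕ (suc k) * r * v ∎

    ∑g : ∑< (suc n) g ≡ riemann (suc n) a + (b - a) * recip a
    ∑g = trans (telescope (suc n) ℕₚ.≤-refl) (cong (λ z → riemann (suc n) a + (b - a) * z)
      (trans (cong₂ _*_ (recip-*ʳ (fromℕ-pos n)) (cong recip (node-end n a))) (*-identityˡ _)))

    f≈g : ∀ i → i ℕ.< suc n → ∣ f i - g i ∣ ≤ c
    f≈g i i<n = begin
      ∣ h′ * u′ - (h * u i + (b - a) * (r * (u i * v))) ∣
        ≡⟨ cong ∣_∣ (cong₂ (λ x y → x - (y + (b - a) * (r * (u i * v)))) (sym (*-identityʳ (h′ * u′))) (sym (*-identityʳ (h * u i)))) ⟩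
      ∣ h′ * u′ * 1ℚ - (h * u i * 1ℚ + (b - a) * (r * (u i * v))) ∣
        ≡⟨ cong ∣_∣ (cong₂ (λ x y → h′ * u′ * x - (h * u i * y + (b - a) * (r * (u i * v)))) (sym uD≡1) (sym uD′≡1)) ⟩
      ∣ h′ * u′ * (D i * u i) - (h * u i * (D′ i * u′) + (b - a) * (r * (u i * v))) ∣
        -- The cross difference `h′ * D i - h * D′ i` equals `(b - a) * r`, free of `i`, so
        -- `(b - a) * r * u i` factors out and a difference of two reciprocals remains.
        ≡⟨ cong ∣_∣ (solve 7 (λ a b r i u u′ v →
             ((b :- con 1ℚ) :* r) :* u′ :* ((con 1ℚ :+ i :* ((a :- con 1ℚ) :* r)) :* u)
               :- (((a :- con 1ℚ) :* r) :* u :* ((con 1ℚ :+ i :* ((b :- con 1ℚ) :* r)) :* u′) :+ (b :- a) :* (r :* (u :* v)))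
             := (b :- a) :* (r :* (u :* (u′ :- v)))) refl a b r (fromℕ i) (u i) u′ v) ⟩
      ∣ (b - a) * (r * (u i * (u′ - v))) ∣
        ≡⟨ trans (∣p*q∣≡∣p∣*∣q∣ (b - a) _) (cong (∣ b - a ∣ *_) (trans (∣p*q∣≡∣p∣*∣q∣ r _)
             (cong₂ _*_ (0≤p⇒∣p∣≡p 0≤r) (trans (∣p*q∣≡∣p∣*∣q∣ (u i) _) (cong (_* ∣ u′ - v ∣) (0≤p⇒∣p∣≡p 0≤u)))))) ⟩
      ∣ b - a ∣ * (r * (u i * ∣ u′ - v ∣))
        ≤⟨ *-monoˡ-≤-nonNeg ∣ b - a ∣ ⦃ ∣-∣-nonNeg (b - a) ⦄ (*-monoˡ-≤-nonNeg r ⦃ nonNegative 0≤r ⦄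
             (*-mono-≤ 0≤u (*-nonneg (*-nonneg 0≤κ 0≤κ) 0≤e)
               (recip-antimono 0<δ (δ≤D (ℕₚ.<⇒≤ i<n)))
               (≤-trans (recip-lipschitz 0<δ (δ≤D′ (ℕₚ.<⇒≤ i<n)) (δ≤D i<n))
                 (*-monoˡ-≤-nonNeg (κ * κ) ⦃ nonNegative (*-nonneg 0≤κ 0≤κ) ⦄ nodes)))) ⟩
      ∣ b - a ∣ * (r * (κ * (κ * κ * e)))
        ≡⟨ solve 4 (λ d r k e → d :* (r :* (k :* (k :* k :* e))) := d :* r :* e :* (k :* (k :* k))) refl ∣ b - a ∣ r κ e ⟩
      c ∎
      where
      u′ = recip (D′ i)
      v = u (suc i)
      0<D = <-≤-trans 0<δ (δ≤D (ℕₚ.<⇒≤ i<n))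
      0<D′ = <-≤-trans 0<δ (δ≤D′ (ℕₚ.<⇒≤ i<n))
      uD≡1 = recip-*ʳ 0<D
      uD′≡1 = recip-*ʳ 0<D′
      0≤u = <⇒≤ (recip-pos 0<D)
      0≤e : 0ℚ ≤ e
      0≤e = +-mono-≤ (0≤∣p∣ (b - a)) (*-nonneg (0≤∣p∣ (a - 1ℚ)) 0≤r)
      nodes : ∣ D′ i - D (suc i) ∣ ≤ e
      nodes = begin
        ∣ D′ i - (1ℚ + fromℕ (suc i) * h) ∣
          ≡⟨ cong (λ z → ∣ D′ i - (1ℚ + z * h) ∣) (fromℕ-suc i) ⟩
        ∣ D′ i - (1ℚ + (fromℕ i + 1ℚ) * h) ∣
          ≡⟨ cong ∣_∣ (solve 4 (λ a b r i →
               (con 1ℚ :+ i :* ((b :- con 1ℚ) :* r)) :- (con 1ℚ :+ (i :+ con 1ℚ) :* ((a :- con 1ℚ) :* r))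
               := (b :- a) :* (i :* r) :- (a :- con 1ℚ) :* r) refl a b r (fromℕ i)) ⟩
        ∣ (b - a) * (fromℕ i * r) - h ∣
          ≤⟨ ∣p-q∣≤∣p∣+∣q∣ ((b - a) * (fromℕ i * r)) h ⟩
        ∣ (b - a) * (fromℕ i * r) ∣ + ∣ h ∣
          ≡⟨ cong₂ _+_ (trans (∣p*q∣≡∣p∣*∣q∣ (b - a) _) (cong (∣ b - a ∣ *_) (0≤p⇒∣p∣≡p (*-nonneg (fromℕ-nonneg i) 0≤r)))) (∣step∣ n a) ⟩
        ∣ b - a ∣ * (fromℕ i * r) + ∣ a - 1ℚ ∣ * r
          ≤⟨ +-monoˡ-≤ (∣ a - 1ℚ ∣ * r) (≤-trans (*-monoˡ-≤-nonNeg ∣ b - a ∣ ⦃ ∣-∣-nonNeg (b - a) ⦄ (fraction≤1 n (ℕₚ.<⇒≤ i<n))) (≤-reflexive (*-identityʳ ∣ b - a ∣))) ⟩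
        e ∎

  ∑<-telescope : ∀ k (F : ℕ → ℚ) → ∑< k (λ i → F (suc i) - F i) ≡ F k - F 0
  ∑<-telescope zero    F = sym (+-inverseʳ (F 0))
  ∑<-telescope (suc k) F = trans (cong (_+ (F (suc k) - F k)) (∑<-telescope k F))
    (solve 3 (λ x y z → (x :- y) :+ (z :- x) := z :- y) refl (F k) (F 0) (F (suc k)))

  -- For `δ` below `p` and `q`, and `C` above the absolute values of `p` and `q - 1`: the points
  -- `p * node n q i` are at least `δ * δ`, successive ones differ by at most `C * C` over `suc n`,
  -- and all lie within `C * (1 + C) + 1` of 1.
  additivity-constant : ℚ → ℚ → ℚ
  additivity-constant δ C = C * C * (C * C + (C * (1ℚ + C) + 1ℚ)) * (κ * (κ * κ))
    where κ = recip (δ * δ)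

  additivity-constant-pos : ∀ {δ C} → 0ℚ < δ → 0ℚ < C → 0ℚ < additivity-constant δ C
  additivity-constant-pos 0<δ 0<C =
    *-pos (*-pos (*-pos 0<C 0<C) (+-pos (*-pos 0<C 0<C) (+-pos (*-pos 0<C (+-pos 0<1 0<C)) 0<1)))
          (*-pos 0<κ (*-pos 0<κ 0<κ))
    where 0<κ = recip-pos (*-pos 0<δ 0<δ)

  -- Multiplication by p carries the partition of [1, q] to one of [p, pq] whose
  -- Riemann sum for dt/t is the same; riemann-step compares it with ∫ₚᵖᑫ dt/t.
  riemann-* : ∀ n {δ C p q} → 0ℚ < δ → δ ≤ 1ℚ → δ ≤ p → δ ≤ q → ∣ p ∣ ≤ C → ∣ q - 1ℚ ∣ ≤ C →
    ∣ riemann (suc n) (p * q) - (riemann (suc n) p + riemann (suc n) q) ∣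
      ≤ additivity-constant δ C * recip (fromℕ (suc n))
  riemann-* n {δ} {C} {p} {q} 0<δ δ≤1 δ≤p δ≤q p≤C q≤C = begin
    ∣ R (p * q) - (R p + R q) ∣
      ≡⟨ cong ∣_∣ (solve 3 (λ x y z → x :- (y :+ z) := (x :- y) :- z) refl (R (p * q)) (R p) (R q)) ⟩
    ∣ (R (p * q) - R p) - R q ∣
      ≡⟨ cong (λ z → ∣ z - R q ∣) (sym ∑f) ⟩
    ∣ ∑< (suc n) f - ∑< (suc n) g ∣
      ≤⟨ ∑<-close (suc n) f g c f≈g ⟩
    N * c
      ≡⟨ solve 5 (λ n r c e k → n :* (c :* c :* r :* (c :* c :* r :+ e :* r) :* k) := (n :* r) :* (c :* c :* (c :* c :+ e) :* k :* r))
           refl N r C E K ⟩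
    N * r * (C * C * (C * C + E) * K * r)
      ≡⟨ trans (cong (_* (C * C * (C * C + E) * K * r)) (recip-*ʳ (fromℕ-pos n))) (*-identityˡ _) ⟩
    C * C * (C * C + E) * K * r ∎
    where
    R = riemann (suc n)
    N = fromℕ (suc n)
    r = recip N
    κ = recip (δ * δ)
    K = κ * (κ * κ)
    E = C * (1ℚ + C) + 1ℚ
    c = C * C * r * (C * C * r + E * r) * K
    h = step (suc n) q
    D = node n q
    a : ℕ → ℚ
    a i = p * D i
    f g : ℕ → ℚ
    f i = R (a (suc i)) - R (a i)
    g i = h * recip (D i)
    0<p = <-≤-trans 0<δ δ≤p
    0≤r = <⇒≤ (recip-pos (fromℕ-pos n))
    0≤δ = <⇒≤ 0<δ
    0<δδ = *-pos 0<δ 0<δ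
    0≤κ = <⇒≤ (recip-pos 0<δδ)
    0≤C = ≤-trans (0≤∣p∣ p) p≤C

    ∑f : ∑< (suc n) f ≡ R (p * q) - R p
    ∑f = trans (∑<-telescope (suc n) (λ i → R (a i))) (cong₂ (λ x y → R x - R y)
      (cong (p *_) (node-end n q)) (solve 2 (λ p h → p :* (con 1ℚ :+ con 0ℚ :* h) := p) refl p h))

    δ≤D : ∀ {i} → i ℕ.≤ suc n → δ ≤ D i
    δ≤D {i} i≤n = node-≥ n i i≤n δ≤1 δ≤q

    δδ≤a : ∀ {i} → i ℕ.≤ suc n → δ * δ ≤ a i
    δδ≤a i≤n = *-mono-≤ 0≤δ (≤-trans 0≤δ (δ≤D i≤n)) δ≤p (δ≤D i≤n)

    δδ≤1 : δ * δ ≤ 1ℚ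
    δδ≤1 = *-mono-≤ 0≤δ (<⇒≤ 0<1) δ≤1 δ≤1

    a-step : ∀ i → a (suc i) - a i ≡ p * h
    a-step i = trans (cong (λ z → p * (1ℚ + z * h) - a i) (fromℕ-suc i))
      (solve 3 (λ p i h → p :* (con 1ℚ :+ (i :+ con 1ℚ) :* h) :- p :* (con 1ℚ :+ i :* h) := p :* h) refl p (fromℕ i) h)

    ∣a-step∣ : ∀ i → ∣ a (suc i) - a i ∣ ≤ C * C * r
    ∣a-step∣ i = begin
      ∣ a (suc i) - a i ∣       ≡⟨ trans (cong ∣_∣ (a-step i)) (∣p*q∣≡∣p∣*∣q∣ p h) ⟩
      ∣ p ∣ * ∣ h ∣             ≡⟨ trans (cong (∣ p ∣ *_) (∣step∣ n q)) (sym (*-assoc ∣ p ∣ _ r)) ⟩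
      ∣ p ∣ * ∣ q - 1ℚ ∣ * r    ≤⟨ *-monoʳ-≤-nonNeg r ⦃ nonNegative 0≤r ⦄ (*-mono-≤ (0≤∣p∣ p) 0≤C p≤C q≤C) ⟩
      C * C * r                 ∎

    a-bound : ∀ {i} → i ℕ.≤ suc n → ∣ a i - 1ℚ ∣ ≤ E
    a-bound {i} i≤n = begin
      ∣ a i - 1ℚ ∣                   ≤⟨ ∣p-q∣≤∣p∣+∣q∣ (a i) 1ℚ ⟩
      ∣ p * D i ∣ + 1ℚ               ≡⟨ cong (_+ 1ℚ) (∣p*q∣≡∣p∣*∣q∣ p (D i)) ⟩
      ∣ p ∣ * ∣ D i ∣ + 1ℚ
        ≤⟨ +-monoˡ-≤ 1ℚ (*-mono-≤ (0≤∣p∣ p) (+-mono-≤ (<⇒≤ 0<1) 0≤C) p≤C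
             (≤-trans (∣p+q∣≤∣p∣+∣q∣ 1ℚ (fromℕ i * h)) (+-monoʳ-≤ 1ℚ ih≤C))) ⟩
      C * (1ℚ + C) + 1ℚ              ∎
      where
      ih≤C : ∣ fromℕ i * h ∣ ≤ C
      ih≤C = begin
        ∣ fromℕ i * h ∣                   ≡⟨ cong ∣_∣ (solve 3 (λ i q r → i :* (q :* r) := q :* (i :* r)) refl (fromℕ i) (q - 1ℚ) r) ⟩
        ∣ (q - 1ℚ) * (fromℕ i * r) ∣      ≡⟨ trans (∣p*q∣≡∣p∣*∣q∣ (q - 1ℚ) _) (cong (∣ q - 1ℚ ∣ *_) (0≤p⇒∣p∣≡p (*-nonneg (fromℕ-nonneg i) 0≤r))) ⟩
        ∣ q - 1ℚ ∣ * (fromℕ i * r)        ≤⟨ *-mono-≤ (0≤∣p∣ (q - 1ℚ)) (<⇒≤ 0<1) q≤C (fraction≤1 n i≤n) ⟩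
        C * 1ℚ                            ≡⟨ *-identityʳ C ⟩
        C                                 ∎

    f≈g : ∀ i → i ℕ.< suc n → ∣ f i - g i ∣ ≤ c
    f≈g i i<n = begin
      ∣ (R (a (suc i)) - R (a i)) - g i ∣
        ≡⟨ cong ∣_∣ (solve 3 (λ x y z → (x :- y) :- z := x :- (y :+ z)) refl (R (a (suc i))) (R (a i)) (g i)) ⟩
      ∣ R (a (suc i)) - (R (a i) + g i) ∣
        ≡⟨ cong (λ z → ∣ R (a (suc i)) - (R (a i) + z) ∣) g≡ ⟩
      ∣ R (a (suc i)) - (R (a i) + (a (suc i) - a i) * recip (a i)) ∣
        ≤⟨ riemann-step n 0<δδ δδ≤1 (δδ≤a (ℕₚ.<⇒≤ i<n)) (δδ≤a i<n) ⟩
      ∣ a (suc i) - a i ∣ * (∣ a (suc i) - a i ∣ + ∣ a i - 1ℚ ∣ * r) * K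
        ≤⟨ *-monoʳ-≤-nonNeg K ⦃ nonNegative (*-nonneg 0≤κ (*-nonneg 0≤κ 0≤κ)) ⦄
             (*-mono-≤ (0≤∣p∣ (a (suc i) - a i)) (+-mono-≤ 0≤CCr (*-nonneg 0≤E 0≤r)) (∣a-step∣ i)
               (+-mono-≤ (∣a-step∣ i) (*-monoʳ-≤-nonNeg r ⦃ nonNegative 0≤r ⦄ (a-bound (ℕₚ.<⇒≤ i<n))))) ⟩
      c ∎
      where
      0<D = <-≤-trans 0<δ (δ≤D (ℕₚ.<⇒≤ i<n))
      0≤CCr = *-nonneg (*-nonneg 0≤C 0≤C) 0≤r
      0≤E = ≤-trans (0≤∣p∣ (a i - 1ℚ)) (a-bound (ℕₚ.<⇒≤ i<n))
      pρ≡1 = recip-*ʳ 0<p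
      Dρ≡1 = recip-*ʳ 0<D
      recip-a : recip (a i) ≡ recip p * recip (D i)
      recip-a = recip-unique (*-pos 0<p 0<D)
        (trans (solve 4 (λ p d x y → (p :* d) :* (x :* y) := (p :* x) :* (d :* y)) refl p (D i) (recip p) (recip (D i)))
               (cong₂ _*_ pρ≡1 Dρ≡1))
      g≡ : g i ≡ (a (suc i) - a i) * recip (a i)
      g≡ = sym (begin-equality
        (a (suc i) - a i) * recip (a i)       ≡⟨ cong₂ _*_ (a-step i) recip-a ⟩
        (p * h) * (recip p * recip (D i))     ≡⟨ solve 4 (λ p h x y → (p :* h) :* (x :* y) := (p :* x) :* (h :* y)) refl p h (recip p) (recip (D i)) ⟩
        (p * recip p) * g i                   ≡⟨ trans (cong (_* g i) pρ≡1) (*-identityˡ _) ⟩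
        g i                                   ∎)

open import Defs
open +-*-Solver using (solve; _:=_; con)
  renaming (_:+_ to _⊕_; _:*_ to _⊗_; _:-_ to _⊝_; :-_ to ⊝_)
open RiemannSums using (riemann-*; additivity-constant; additivity-constant-pos)
open Estimates

-- Equality of Cauchy reals as a congruence.

private variable
  x x′ y y′ z : ℝ
  m : ℕ

map-eventually : ∀ {P Q : ℕ → Set} → (∀ n → P n → Q n) → Eventually P → Eventually Q
map-eventually f (N , p) = N , λ n n≥ → f n (p n n≥)

zip-eventually : ∀ {P Q R : ℕ → Set} → (∀ n → P n → Q n → R n) →
                 Eventually P → Eventually Q → Eventually R
zip-eventually f (M , p) (N , q) = M ℕ.⊔ N , λ n n≥ →
  f n (p n (ℕₚ.m⊔n≤o⇒m≤o M N n≥)) (q n (ℕₚ.m⊔n≤o⇒n≤o M N n≥))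

infix 4 _≃_

-- _≈_ computes to a statement about rationals from which its two arguments
-- cannot be inferred; this wrapper makes them inferable.
record _≃_ (x y : ℝ) : Set where
  constructor ⟦_⟧
  field unwrap : x ≈ y

open _≃_

≃-eventually : Eventually (λ n → seq x n ≡ seq y n) → x ≃ y
≃-eventually {x} {y} e = ⟦ (λ ε 0<ε → map-eventually
  (λ n x≡y → ℚₚ.≤-trans (ℚₚ.≤-reflexive (trans (cong (λ q → ℚ.∣ q ℚ.- seq y n ∣) x≡y) (cong ℚ.∣_∣ (ℚₚ.+-inverseʳ (seq y n))))) (ℚₚ.<⇒≤ 0<ε)) e) ⟧

≃-pointwise : (∀ n → seq x n ≡ seq y n) → x ≃ y
≃-pointwise e = ≃-eventually (0 , λ n _ → e n)

-- Absorbs the constants that the estimates produce: the hypothesis is applied to `recip K * ε`.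
≃-scaled : ∀ K → 0ℚ ℚ.< K →
  (∀ ε → 0ℚ ℚ.< ε → Eventually (λ n → ℚ.∣ seq x n ℚ.- seq y n ∣ ℚ.≤ K ℚ.* ε)) → x ≃ y
≃-scaled K 0<K p = ⟦ (λ ε 0<ε → map-eventually
  (λ n le → ℚₚ.≤-trans le (ℚₚ.≤-reflexive
    (trans (sym (ℚₚ.*-assoc K (recip K) ε)) (trans (cong (ℚ._* ε) (recip-*ʳ 0<K)) (ℚₚ.*-identityˡ ε)))))
  (p (recip K ℚ.* ε) (*-pos (recip-pos 0<K) 0<ε))) ⟧

p≤p+q : ∀ p {q} → 0ℚ ℚ.≤ q → p ℚ.≤ p ℚ.+ q
p≤p+q p {q} 0≤q = ℚₚ.≤-trans (ℚₚ.≤-reflexive (sym (ℚₚ.+-identityʳ p))) (ℚₚ.+-monoʳ-≤ p 0≤q)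

0<2 : 0ℚ ℚ.< 1ℚ ℚ.+ 1ℚ
0<2 = +-pos 0<1 0<1

double : ∀ ε → ε ℚ.+ ε ≡ (1ℚ ℚ.+ 1ℚ) ℚ.* ε
double = solve 1 (λ e → e ⊕ e := (con 1ℚ ⊕ con 1ℚ) ⊗ e) refl

≃-refl : x ≃ x
≃-refl = ≃-pointwise (λ _ → refl)

≡⇒≃ : x ≡ y → x ≃ y
≡⇒≃ refl = ≃-refl

≃-sym : x ≃ y → y ≃ x
≃-sym {x} {y} ⟦ p ⟧ = ⟦ (λ ε 0<ε → map-eventually
  (λ n → ℚₚ.≤-trans (ℚₚ.≤-reflexive (dist-sym (seq y n) (seq x n)))) (p ε 0<ε)) ⟧

≃-trans : x ≃ y → y ≃ z → x ≃ z
≃-trans {x} {y} {z} ⟦ p ⟧ ⟦ q ⟧ = ≃-scaled _ 0<2 λ ε 0<ε → zip-eventually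
  (λ n xy yz → ℚₚ.≤-trans (tri (seq x n) (seq y n) (seq z n))
    (ℚₚ.≤-trans (ℚₚ.+-mono-≤ xy yz) (ℚₚ.≤-reflexive (double ε)))) (p ε 0<ε) (q ε 0<ε)

≃-setoid : Setoid _ _
≃-setoid = record
  { Carrier = ℝ ; _≈_ = _≃_
  ; isEquivalence = record { refl = ≃-refl ; sym = ≃-sym ; trans = ≃-trans } }

open SetoidReasoning ≃-setoid

-- The congruence lemmas take their endpoints explicitly, and definitionally equal
-- reals are identified by ≃-pointwise λ _ → refl: otherwise Agda unfolds and
-- compares the Cauchy proofs, which is prohibitively slow.
+-cong : ∀ x x′ y y′ → x ≃ x′ → y ≃ y′ → x + y ≃ x′ + y′
+-cong x x′ y y′ ⟦ p ⟧ ⟦ q ⟧ = ≃-scaled _ 0<2 λ ε 0<ε → zip-eventually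
  (λ n xx yy → ℚₚ.≤-trans
    (ℚₚ.≤-reflexive (cong ℚ.∣_∣ (solve 4 (λ a b c d → (a ⊕ b) ⊝ (c ⊕ d) := (a ⊝ c) ⊕ (b ⊝ d)) refl
      (seq x n) (seq y n) (seq x′ n) (seq y′ n))))
    (ℚₚ.≤-trans (ℚₚ.∣p+q∣≤∣p∣+∣q∣ (seq x n ℚ.- seq x′ n) (seq y n ℚ.- seq y′ n))
    (ℚₚ.≤-trans (ℚₚ.+-mono-≤ xx yy) (ℚₚ.≤-reflexive (double ε))))) (p ε 0<ε) (q ε 0<ε)

-‿cong : ∀ x x′ → x ≃ x′ → - x ≃ - x′
-‿cong x x′ ⟦ p ⟧ = ⟦ (λ ε 0<ε → map-eventually
  (λ n → ℚₚ.≤-trans (ℚₚ.≤-reflexive (trans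
    (cong ℚ.∣_∣ (solve 2 (λ a b → ⊝ a ⊝ ⊝ b := ⊝ (a ⊝ b)) refl (seq x n) (seq x′ n)))
    (ℚₚ.∣-p∣≡∣p∣ (seq x n ℚ.- seq x′ n))))) (p ε 0<ε)) ⟧

*-cong : ∀ x x′ y y′ → x ≃ x′ → y ≃ y′ → x * y ≃ x′ * y′
*-cong x x′ y y′ ⟦ p ⟧ ⟦ q ⟧ =
  -- The splitting `a b - c d = a (b - d) + d (a - c)` leaves `x` and `y′` as outer factors, so
  -- their bounds add up to the constant.
  let B , 0<B , b = CauchyProofs.bounded x
      C , 0<C , c = CauchyProofs.bounded y′
  in ≃-scaled (B ℚ.+ C) (+-pos 0<B 0<C) λ ε 0<ε → zip-eventually
    (λ n (x≤B , yy) (y′≤C , xx) → ℚₚ.≤-trans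
      (ℚₚ.≤-reflexive (cong ℚ.∣_∣ (solve 4 (λ a b c d → a ⊗ b ⊝ c ⊗ d := a ⊗ (b ⊝ d) ⊕ d ⊗ (a ⊝ c)) refl
        (seq x n) (seq y n) (seq x′ n) (seq y′ n))))
      (ℚₚ.≤-trans (ℚₚ.∣p+q∣≤∣p∣+∣q∣ (seq x n ℚ.* (seq y n ℚ.- seq y′ n)) (seq y′ n ℚ.* (seq x n ℚ.- seq x′ n)))
      (ℚₚ.≤-trans (ℚₚ.≤-reflexive (cong₂ ℚ._+_ (ℚₚ.∣p*q∣≡∣p∣*∣q∣ (seq x n) _) (ℚₚ.∣p*q∣≡∣p∣*∣q∣ (seq y′ n) _)))
      (ℚₚ.≤-trans (ℚₚ.+-mono-≤ (*-mono-≤ (ℚₚ.0≤∣p∣ (seq x n)) (ℚₚ.<⇒≤ 0<ε) x≤B yy)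
                               (*-mono-≤ (ℚₚ.0≤∣p∣ (seq y′ n)) (ℚₚ.<⇒≤ 0<ε) y′≤C xx))
        (ℚₚ.≤-reflexive (sym (ℚₚ.*-distribʳ-+ ε B C)))))))
    (zip-eventually (λ _ → _,_) b (q ε 0<ε)) (zip-eventually (λ _ → _,_) c (p ε 0<ε))

-- Arithmetic of differences and quotients.

minus-cong : ∀ x x′ y y′ → x ≃ x′ → y ≃ y′ → x - y ≃ x′ - y′
minus-cong x x′ y y′ p q = +-cong x x′ (- y) (- y′) p (-‿cong y y′ q)

minus-congˡ : ∀ z x y → x ≃ y → z - x ≃ z - y
minus-congˡ z x y = minus-cong z z x y ≃-refl

minus-congʳ : ∀ z x y → x ≃ y → x - z ≃ y - z
minus-congʳ z x y x≃y = minus-cong x y z z x≃y ≃-refl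

minus-neg : ∀ x y → x - y ≃ - y - - x
minus-neg x y = ≃-pointwise λ n → solve 2 (λ x y → x ⊝ y := ⊝ y ⊝ ⊝ x) refl (seq x n) (seq y n)

*-congˡ : ∀ z x y → x ≃ y → z * x ≃ z * y
*-congˡ z x y x≃y = *-cong z z x y ≃-refl x≃y

*-congʳ : ∀ z x y → x ≃ y → x * z ≃ y * z
*-congʳ z x y x≃y = *-cong x y z z x≃y ≃-refl

*-zeroʳ : ∀ x → x * 0ℝ ≃ 0ℝ
*-zeroʳ x = ≃-pointwise λ n → ℚₚ.*-zeroʳ (seq x n)

*-zeroˡ : ∀ x → 0ℝ * x ≃ 0ℝ
*-zeroˡ x = ≃-pointwise λ n → ℚₚ.*-zeroˡ (seq x n)

*-identityˡ : ∀ x → 1ℝ * x ≃ x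
*-identityˡ x = ≃-pointwise λ n → ℚₚ.*-identityˡ (seq x n)

*-identityʳ : ∀ x → x * 1ℝ ≃ x
*-identityʳ x = ≃-pointwise λ n → ℚₚ.*-identityʳ (seq x n)

*-inverse : ∀ x (0<x : 0ℝ < x) → x * inverse x 0<x ≃ 1ℝ
*-inverse x 0<x =
  let δ , 0<δ , e = CauchyProofs.bounded-below {x} 0<x
  in ≃-eventually (map-eventually (λ n δ≤x → recip-*ʳ (ℚₚ.<-≤-trans 0<δ δ≤x)) e)

/-* : ∀ x y (0<y : 0ℝ < y) → (x / y [ 0<y ]) * y ≃ x
/-* x y 0<y = begin
  (x / y [ 0<y ]) * y       ≈⟨ ≃-pointwise (λ n → solve 3 (λ x r y → x ⊗ r ⊗ y := x ⊗ (y ⊗ r)) refl (seq x n) (recip (seq y n)) (seq y n)) ⟩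
  x * (y * inverse y 0<y)   ≈⟨ *-congˡ x (y * inverse y 0<y) 1ℝ (*-inverse y 0<y) ⟩
  x * 1ℝ                    ≈⟨ *-identityʳ x ⟩
  x                         ∎

*-/ : ∀ x y (0<y : 0ℝ < y) → (x * y) / y [ 0<y ] ≃ x
*-/ x y 0<y = begin
  (x * y) / y [ 0<y ]       ≈⟨ ≃-pointwise (λ n → ℚₚ.*-assoc (seq x n) (seq y n) (recip (seq y n))) ⟩
  x * (y * inverse y 0<y)   ≈⟨ *-congˡ x (y * inverse y 0<y) 1ℝ (*-inverse y 0<y) ⟩
  x * 1ℝ                    ≈⟨ *-identityʳ x ⟩
  x                         ∎

/-distribʳ-+ : ∀ x y z (0<z : 0ℝ < z) → (x + y) / z [ 0<z ] ≃ (x / z [ 0<z ]) + (y / z [ 0<z ])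
/-distribʳ-+ x y z 0<z = ≃-pointwise λ n → ℚₚ.*-distribʳ-+ (recip (seq z n)) (seq x n) (seq y n)

/-congʳ : ∀ z x y (0<z : 0ℝ < z) → x ≃ y → x / z [ 0<z ] ≃ y / z [ 0<z ]
/-congʳ z x y 0<z = *-congʳ (inverse z 0<z) x y

*-cancelʳ : ∀ x y z → 0ℝ < z → x * z ≃ y * z → x ≃ y
*-cancelʳ x y z 0<z xz≃yz = begin
  x                        ≈⟨ *-/ x z 0<z ⟨
  (x * z) / z [ 0<z ]      ≈⟨ /-congʳ z (x * z) (y * z) 0<z xz≃yz ⟩
  (y * z) / z [ 0<z ]      ≈⟨ *-/ y z 0<z ⟩
  y                        ∎

-- With `a = ν(σ)`, `b = μ(τ)`, `c = ν(τ)`, `d = μ(σ)` this is the density identity for the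
-- conditional measures. Since `recip 0ℚ` is `0ℚ`, the quotients `b / b`, `(d / a) / (d / a)` and
-- `a / a` are 1 only eventually; they are exchanged for `1ℝ` up to `≃`, and the rest is a
-- regrouping of factors valid at every index.
quotient-of-ratios : ∀ a b c d (0<a : 0ℝ < a) (0<b : 0ℝ < b) (0<c : 0ℝ < c) (0<r : 0ℝ < d / a [ 0<a ]) →
  a / c [ 0<c ] ≃ ((b / c [ 0<c ]) / (d / a [ 0<a ]) [ 0<r ]) * (d / b [ 0<b ])
quotient-of-ratios a b c d 0<a 0<b 0<c 0<r = begin
  a / c [ 0<c ]
    ≈⟨ ≃-pointwise (λ n → solve 2 (λ a c → a ⊗ c := (a ⊗ c) ⊗ (con 1ℚ ⊗ con 1ℚ)) refl (seq a n) (recip (seq c n))) ⟩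
  (a / c [ 0<c ]) * (1ℝ * 1ℝ)
    ≈⟨ *-congˡ (a / c [ 0<c ]) ((b / b [ 0<b ]) * ((d / a [ 0<a ]) / (d / a [ 0<a ]) [ 0<r ])) (1ℝ * 1ℝ)
         (*-cong (b / b [ 0<b ]) 1ℝ ((d / a [ 0<a ]) / (d / a [ 0<a ]) [ 0<r ]) 1ℝ
           (*-inverse b 0<b) (*-inverse (d / a [ 0<a ]) 0<r)) ⟨
  (a / c [ 0<c ]) * ((b / b [ 0<b ]) * ((d / a [ 0<a ]) / (d / a [ 0<a ]) [ 0<r ]))
    ≈⟨ ≃-pointwise (λ n → solve 7 (λ a a⁻¹ b b⁻¹ c⁻¹ d r⁻¹ →
         (a ⊗ c⁻¹) ⊗ ((b ⊗ b⁻¹) ⊗ ((d ⊗ a⁻¹) ⊗ r⁻¹)) := (((b ⊗ c⁻¹) ⊗ r⁻¹) ⊗ (d ⊗ b⁻¹)) ⊗ (a ⊗ a⁻¹)) refl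
         (seq a n) (recip (seq a n)) (seq b n) (recip (seq b n)) (recip (seq c n)) (seq d n)
         (recip (seq d n ℚ.* recip (seq a n)))) ⟩
  ((b / c [ 0<c ]) / (d / a [ 0<a ]) [ 0<r ]) * (d / b [ 0<b ]) * (a * inverse a 0<a)
    ≈⟨ *-congˡ (((b / c [ 0<c ]) / (d / a [ 0<a ]) [ 0<r ]) * (d / b [ 0<b ])) (a * inverse a 0<a) 1ℝ (*-inverse a 0<a) ⟩
  ((b / c [ 0<c ]) / (d / a [ 0<a ]) [ 0<r ]) * (d / b [ 0<b ]) * 1ℝ
    ≈⟨ *-identityʳ (((b / c [ 0<c ]) / (d / a [ 0<a ]) [ 0<r ]) * (d / b [ 0<b ])) ⟩
  ((b / c [ 0<c ]) / (d / a [ 0<a ]) [ 0<r ]) * (d / b [ 0<b ]) ∎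

-- For `p` and `q` the conditional probabilities of the two children, this turns a mean increment
-- into a conditional mean minus the current value.
weighted-difference : ∀ x y z p q → p + q ≃ 1ℝ → (x - z) * p + (y - z) * q ≃ (x * p + y * q) - z
weighted-difference x y z p q p+q≃1 = begin
  (x - z) * p + (y - z) * q
    ≈⟨ ≃-pointwise (λ n → solve 5 (λ x y z p q → (x ⊝ z) ⊗ p ⊕ (y ⊝ z) ⊗ q := (x ⊗ p ⊕ y ⊗ q) ⊝ z ⊗ (p ⊕ q)) refl
         (seq x n) (seq y n) (seq z n) (seq p n) (seq q n)) ⟩
  (x * p + y * q) - z * (p + q)
    ≈⟨ minus-congˡ (x * p + y * q) (z * (p + q)) (z * 1ℝ) (*-congˡ z (p + q) 1ℝ p+q≃1) ⟩
  (x * p + y * q) - z * 1ℝ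
    ≈⟨ minus-congˡ (x * p + y * q) (z * 1ℝ) z (*-identityʳ z) ⟩
  (x * p + y * q) - z ∎

-- Order, positivity and vanishing.

<⇒≤ : ∀ x → 0ℝ < x → 0ℝ ≤ x
<⇒≤ x (δ , 0<δ , e) ε 0<ε = map-eventually
  (λ n δ≤x → ℚₚ.≤-trans (ℚₚ.+-monoʳ-≤ 0ℚ (ℚₚ.<⇒≤ 0<δ)) (ℚₚ.≤-trans δ≤x
    (p≤p+q (seq x n) (ℚₚ.<⇒≤ 0<ε)))) e

0≤0 : 0ℝ ≤ 0ℝ
0≤0 ε 0<ε = 0 , λ _ _ → p≤p+q 0ℚ (ℚₚ.<⇒≤ 0<ε)

<⇒≄ : ∀ x → 0ℝ < x → ¬ x ≃ 0ℝ
<⇒≄ x 0<x ⟦ x≈0 ⟧ =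
  let δ , 0<δ , e = CauchyProofs.bounded-below {x} 0<x
      -- A tolerance strictly below `δ`, so that `δ ≤ ∣ seq x n ∣ ≤ η` is absurd.
      η , 0<η , η<δ = ℚₚ.<-dense 0<δ
      N , p = zip-eventually (λ n δ≤x x≤η → ℚₚ.≤-trans δ≤x (ℚₚ.≤-trans (p≤∣p∣ (seq x n))
                (ℚₚ.≤-trans (ℚₚ.≤-reflexive (cong ℚ.∣_∣ (sym (ℚₚ.+-identityʳ (seq x n))))) x≤η)))
                e (x≈0 η 0<η)
  in ℚₚ.<-irrefl refl (ℚₚ.<-≤-trans η<δ (p N ℕₚ.≤-refl))

*-positive : ∀ x y → 0ℝ < x → 0ℝ < y → 0ℝ < x * y
*-positive x y 0<x 0<y =
  let δ , 0<δ , d = CauchyProofs.bounded-below {x} 0<x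
      η , 0<η , e = CauchyProofs.bounded-below {y} 0<y
  in δ ℚ.* η , *-pos 0<δ 0<η , zip-eventually
    (λ n δ≤x η≤y → ℚₚ.≤-trans (ℚₚ.≤-reflexive (ℚₚ.+-identityˡ (δ ℚ.* η)))
      (*-mono-≤ (ℚₚ.<⇒≤ 0<δ) (ℚₚ.≤-trans (ℚₚ.<⇒≤ 0<η) η≤y) δ≤x η≤y)) d e

+-nonneg : ∀ x y → 0ℝ ≤ x → 0ℝ ≤ y → 0ℝ ≤ x + y
+-nonneg x y 0≤x 0≤y ε 0<ε =
  -- The tolerance is split into the positive parts `q` and `ε - q`, one for each hypothesis.
  let q , 0<q , q<ε = ℚₚ.<-dense 0<ε
      0<ε-q = ℚₚ.<-respˡ-≡ (ℚₚ.+-inverseʳ q) (ℚₚ.+-monoˡ-< (ℚ.- q) q<ε)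
  in zip-eventually (λ n a b → ℚₚ.≤-trans (ℚₚ.+-mono-≤ a b) (ℚₚ.≤-reflexive
       (solve 4 (λ x y q e → (x ⊕ q) ⊕ (y ⊕ (e ⊝ q)) := (x ⊕ y) ⊕ e) refl (seq x n) (seq y n) q ε)))
     (0≤x q 0<q) (0≤y (ε ℚ.- q) 0<ε-q)

≤-respʳ-≃ : ∀ x y → 0ℝ ≤ x → x ≃ y → 0ℝ ≤ y
≤-respʳ-≃ x y 0≤x ⟦ x≈y ⟧ ε 0<ε =
  let q , 0<q , q<ε = ℚₚ.<-dense 0<ε
      0<ε-q = ℚₚ.<-respˡ-≡ (ℚₚ.+-inverseʳ q) (ℚₚ.+-monoˡ-< (ℚ.- q) q<ε)
  in zip-eventually (λ n 0≤xq xy → ℚₚ.≤-trans 0≤xq (ℚₚ.≤-trans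
       (ℚₚ.≤-reflexive (solve 3 (λ x y q → x ⊕ q := (x ⊝ y) ⊕ (y ⊕ q)) refl (seq x n) (seq y n) q))
       (ℚₚ.≤-trans (ℚₚ.+-monoˡ-≤ (seq y n ℚ.+ q) (ℚₚ.≤-trans (p≤∣p∣ _) xy))
       (ℚₚ.≤-reflexive (solve 3 (λ y q e → (e ⊝ q) ⊕ (y ⊕ q) := y ⊕ e) refl (seq y n) q ε)))))
     (0≤x q 0<q) (x≈y (ε ℚ.- q) 0<ε-q)

≤-antisym-0 : ∀ x → 0ℝ ≤ x → 0ℝ ≤ - x → x ≃ 0ℝ
≤-antisym-0 x 0≤x 0≤-x = ⟦ (λ ε 0<ε → zip-eventually (λ n a b → abs n ε a b) (0≤x ε 0<ε) (0≤-x ε 0<ε)) ⟧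
  where
  abs : ∀ n ε → 0ℚ ℚ.≤ seq x n ℚ.+ ε → 0ℚ ℚ.≤ ℚ.- seq x n ℚ.+ ε → ℚ.∣ seq x n ℚ.- 0ℚ ∣ ℚ.≤ ε
  abs n ε a b with ℚₚ.∣p∣≡p∨∣p∣≡-p (seq x n ℚ.- 0ℚ)
  ... | inj₁ e = ℚₚ.≤-trans (ℚₚ.≤-reflexive e) (ℚₚ.≤-trans (p≤p+q (seq x n ℚ.- 0ℚ) b)
                   (ℚₚ.≤-reflexive (solve 2 (λ x e → (x ⊝ con 0ℚ) ⊕ (⊝ x ⊕ e) := e) refl (seq x n) ε)))
  ... | inj₂ e = ℚₚ.≤-trans (ℚₚ.≤-reflexive e) (ℚₚ.≤-trans (p≤p+q (ℚ.- (seq x n ℚ.- 0ℚ)) a)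
                   (ℚₚ.≤-reflexive (solve 2 (λ x e → ⊝ (x ⊝ con 0ℚ) ⊕ (x ⊕ e) := e) refl (seq x n) ε)))

-- Here `- x ≃ y`, so both `x` and `- x` are nonnegative.
+-vanishˡ : ∀ x y → 0ℝ ≤ x → 0ℝ ≤ y → x + y ≃ 0ℝ → x ≃ 0ℝ
+-vanishˡ x y 0≤x 0≤y x+y≃0 = ≤-antisym-0 x 0≤x (≤-respʳ-≃ y (- x) 0≤y (begin
  y             ≈⟨ ≃-pointwise (λ n → solve 2 (λ x y → y := (x ⊕ y) ⊝ x) refl (seq x n) (seq y n)) ⟩
  (x + y) - x   ≈⟨ minus-congʳ x (x + y) 0ℝ x+y≃0 ⟩
  0ℝ - x        ≈⟨ ≃-pointwise (λ n → ℚₚ.+-identityˡ (ℚ.- seq x n)) ⟩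
  - x           ∎))

+-vanishʳ : ∀ x y → 0ℝ ≤ x → 0ℝ ≤ y → x + y ≃ 0ℝ → y ≃ 0ℝ
+-vanishʳ x y 0≤x 0≤y x+y≃0 = +-vanishˡ y x 0≤y 0≤x
  (≃-trans {y = x + y} (≃-pointwise λ n → ℚₚ.+-comm (seq y n) (seq x n)) x+y≃0)

-- The functional equation of the logarithm.

-- The cap at 1 is needed because the nodes of a Riemann sum lie between 1 and its argument, so a
-- lower bound for them must also be at most 1.
common-bound : ∀ x y → 0ℝ < x → 0ℝ < y →
  ∃[ δ ] (0ℚ ℚ.< δ × δ ℚ.≤ 1ℚ × Eventually (λ n → δ ℚ.≤ seq x n × δ ℚ.≤ seq y n))
common-bound x y 0<x 0<y =
  let δ , 0<δ , d = CauchyProofs.bounded-below {x} 0<x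
      η , 0<η , e = CauchyProofs.bounded-below {y} 0<y
  in (δ ℚ.⊓ η) ℚ.⊓ 1ℚ , ⊓-pos (⊓-pos 0<δ 0<η) 0<1 , ℚₚ.p⊓q≤q (δ ℚ.⊓ η) 1ℚ , zip-eventually
    (λ n δ≤x η≤y → ℚₚ.≤-trans (ℚₚ.p⊓q≤p (δ ℚ.⊓ η) 1ℚ) (ℚₚ.≤-trans (ℚₚ.p⊓q≤p δ η) δ≤x)
                 , ℚₚ.≤-trans (ℚₚ.p⊓q≤p (δ ℚ.⊓ η) 1ℚ) (ℚₚ.≤-trans (ℚₚ.p⊓q≤q δ η) η≤y)) d e
  where
  ⊓-pos : ∀ {p q} → 0ℚ ℚ.< p → 0ℚ ℚ.< q → 0ℚ ℚ.< p ℚ.⊓ q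
  ⊓-pos {p} {q} 0<p 0<q with ℚₚ.⊓-sel p q
  ... | inj₁ e = subst (0ℚ ℚ.<_) (sym e) 0<p
  ... | inj₂ e = subst (0ℚ ℚ.<_) (sym e) 0<q

-- The Riemann sums are Lipschitz above `δ` with a constant independent of their index.
ln-cong : ∀ x y (0<x : 0ℝ < x) (0<y : 0ℝ < y) → x ≃ y → ln x 0<x ≃ ln y 0<y
ln-cong x y 0<x 0<y ⟦ x≈y ⟧ =
  let δ , 0<δ , δ≤1 , e = common-bound x y 0<x 0<y
      0<K = *-pos (recip-pos 0<δ) (recip-pos 0<δ)
  in ≃-scaled (recip δ ℚ.* recip δ) 0<K λ ε 0<ε → zip-eventually
    (λ n (δ≤x , δ≤y) xy → ℚₚ.≤-trans (riemann-lipschitz n 0<δ δ≤1 δ≤x δ≤y)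
      (ℚₚ.*-monoˡ-≤-nonNeg (recip δ ℚ.* recip δ) ⦃ ℚ.nonNegative (ℚₚ.<⇒≤ 0<K) ⦄ xy))
    e (x≈y ε 0<ε)

-- The positivity proof enters only the Cauchy proof of the logarithm, not its approximating
-- sequence.
ln-irrelevant : ∀ x (p q : 0ℝ < x) → ln x p ≃ ln x q
ln-irrelevant x p q = ≃-pointwise λ _ → refl

-- At index `n` the defect is at most a constant times `recip (fromℕ (suc n))`, by `riemann-*`, and
-- this tends to 0.
ln-* : ∀ x y (0<x : 0ℝ < x) (0<y : 0ℝ < y) (0<xy : 0ℝ < x * y) →
       ln (x * y) 0<xy ≃ ln x 0<x + ln y 0<y
ln-* x y 0<x 0<y 0<xy =
  let δ , 0<δ , δ≤1 , d = common-bound x y 0<x 0<y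
      A , 0<A , a = CauchyProofs.bounded x
      B , 0<B , b = CauchyProofs.bounded y
  in estimate 0<δ δ≤1 0<A 0<B d (zip-eventually (λ _ → _,_) a b)
  where
  estimate : ∀ {δ A B} → 0ℚ ℚ.< δ → δ ℚ.≤ 1ℚ → 0ℚ ℚ.< A → 0ℚ ℚ.< B →
    Eventually (λ n → δ ℚ.≤ seq x n × δ ℚ.≤ seq y n) →
    Eventually (λ n → ℚ.∣ seq x n ∣ ℚ.≤ A × ℚ.∣ seq y n ∣ ℚ.≤ B) →
    ln (x * y) 0<xy ≃ ln x 0<x + ln y 0<y
  estimate {δ} {A} {B} 0<δ δ≤1 0<A 0<B below above = ≃-scaled K 0<K λ ε 0<ε → zip-eventually
    (λ n ((δ≤x , δ≤y) , x≤A , y≤B) r≤ε → ℚₚ.≤-trans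
      (riemann-* n 0<δ δ≤1 δ≤x δ≤y (ℚₚ.≤-trans x≤A A≤C)
        (ℚₚ.≤-trans (ℚₚ.∣p-q∣≤∣p∣+∣q∣ (seq y n) 1ℚ) (ℚₚ.≤-trans (ℚₚ.+-monoˡ-≤ 1ℚ y≤B) B+1≤C)))
      (ℚₚ.*-monoˡ-≤-nonNeg K ⦃ ℚ.nonNegative (ℚₚ.<⇒≤ 0<K) ⦄ r≤ε))
    (zip-eventually (λ _ → _,_) below above) (archimedean ε 0<ε)
    where
    -- A single constant above both `A` and `B + 1`, the latter bounding `∣ seq y n - 1 ∣`.
    C   = A ℚ.+ (B ℚ.+ 1ℚ)
    0<C = +-pos 0<A (+-pos 0<B 0<1)
    K   = additivity-constant δ C
    0<K = additivity-constant-pos 0<δ 0<C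
    A≤C = p≤p+q A (ℚₚ.<⇒≤ (+-pos 0<B 0<1))
    B+1≤C = ℚₚ.≤-trans (ℚₚ.≤-reflexive (sym (ℚₚ.+-identityˡ (B ℚ.+ 1ℚ)))) (ℚₚ.+-monoˡ-≤ (B ℚ.+ 1ℚ) (ℚₚ.<⇒≤ 0<A))

+-cancel : ∀ x y → (x + y) - y ≃ x
+-cancel x y = ≃-pointwise λ n → solve 2 (λ a b → (a ⊕ b) ⊝ b := a) refl (seq x n) (seq y n)

ln-quotient : ∀ q x y (0<q : 0ℝ < q) (0<x : 0ℝ < x) (0<y : 0ℝ < y) → q * y ≃ x →
              ln q 0<q ≃ ln x 0<x - ln y 0<y
ln-quotient q x y 0<q 0<x 0<y qy≃x = begin
  ln q 0<q                              ≈⟨ +-cancel (ln q 0<q) (ln y 0<y) ⟨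
  (ln q 0<q + ln y 0<y) - ln y 0<y      ≈⟨ minus-congʳ (ln y 0<y) (ln (q * y) (*-positive q y 0<q 0<y)) (ln q 0<q + ln y 0<y)
                                             (ln-* q y 0<q 0<y (*-positive q y 0<q 0<y)) ⟨
  ln (q * y) (*-positive q y 0<q 0<y) - ln y 0<y
                                        ≈⟨ minus-congʳ (ln y 0<y) (ln (q * y) (*-positive q y 0<q 0<y)) (ln x 0<x)
                                             (ln-cong (q * y) x (*-positive q y 0<q 0<y) 0<x qy≃x) ⟩
  ln x 0<x - ln y 0<y                   ∎

-- Finite sums over atoms.

∑-cong : (F G : Atom m → ℝ) → (∀ σ → F σ ≃ G σ) → ∑ F ≃ ∑ G
∑-cong {zero}  F G p = p []
∑-cong {suc m} F G p = +-cong
  (∑ (λ τ → F (false ∷ τ))) (∑ (λ τ → G (false ∷ τ))) (∑ (λ τ → F (true ∷ τ))) (∑ (λ τ → G (true ∷ τ)))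
  (∑-cong (λ τ → F (false ∷ τ)) (λ τ → G (false ∷ τ)) (λ σ → p (false ∷ σ)))
  (∑-cong (λ τ → F (true ∷ τ)) (λ τ → G (true ∷ τ)) (λ σ → p (true ∷ σ)))

∑-zero : ∀ m → ∑ {m} (λ _ → 0ℝ) ≃ 0ℝ
∑-zero zero    = ≃-refl
∑-zero (suc m) = ≃-trans (+-cong (∑ {m} (λ _ → 0ℝ)) 0ℝ (∑ {m} (λ _ → 0ℝ)) 0ℝ (∑-zero m) (∑-zero m))
  (≃-pointwise λ _ → ℚₚ.+-identityˡ 0ℚ)

∑-null : (F : Atom m → ℝ) → (∀ σ → F σ ≃ 0ℝ) → ∑ F ≃ 0ℝ
∑-null {m} F p = ≃-trans (∑-cong F (λ _ → 0ℝ) p) (∑-zero m)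

-- With `∑-trueHalf`, for following a fixed string bit by bit when the half of the sum on the other
-- side of each bit vanishes.
∑-falseHalf : (F : Atom (suc m) → ℝ) (x : ℝ) →
  ∑ (λ σ → F (false ∷ σ)) ≃ x → ∑ (λ σ → F (true ∷ σ)) ≃ 0ℝ → ∑ F ≃ x
∑-falseHalf F x p q = ≃-trans
  (+-cong (∑ (λ σ → F (false ∷ σ))) x (∑ (λ σ → F (true ∷ σ))) 0ℝ p q)
  (≃-pointwise λ n → ℚₚ.+-identityʳ (seq x n))

∑-trueHalf : (F : Atom (suc m) → ℝ) (x : ℝ) →
  ∑ (λ σ → F (false ∷ σ)) ≃ 0ℝ → ∑ (λ σ → F (true ∷ σ)) ≃ x → ∑ F ≃ x
∑-trueHalf F x p q = ≃-trans
  (+-cong (∑ (λ σ → F (false ∷ σ))) 0ℝ (∑ (λ σ → F (true ∷ σ))) x p q)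
  (≃-pointwise λ n → ℚₚ.+-identityˡ (seq x n))

∑-nonneg : ∀ {m} (F : Atom m → ℝ) → (∀ σ → 0ℝ ≤ F σ) → 0ℝ ≤ ∑ F
∑-nonneg {zero}  F p = p []
∑-nonneg {suc m} F p = +-nonneg (∑ (λ τ → F (false ∷ τ))) (∑ (λ τ → F (true ∷ τ)))
  (∑-nonneg (λ τ → F (false ∷ τ)) (λ σ → p (false ∷ σ))) (∑-nonneg (λ τ → F (true ∷ τ)) (λ σ → p (true ∷ σ)))

-- Both halves of the sum are nonnegative, so each vanishes; the bits of the atom choose the half in
-- which to continue.
∑-vanish : ∀ {m} (F : Atom m → ℝ) → (∀ σ → 0ℝ ≤ F σ) → ∑ F ≃ 0ℝ → ∀ σ → F σ ≃ 0ℝ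
∑-vanish F p e []          = e
∑-vanish F p e (false ∷ σ) = ∑-vanish (λ τ → F (false ∷ τ)) (λ τ → p (false ∷ τ))
  (+-vanishˡ (∑ (λ τ → F (false ∷ τ))) (∑ (λ τ → F (true ∷ τ)))
    (∑-nonneg _ (λ τ → p (false ∷ τ))) (∑-nonneg _ (λ τ → p (true ∷ τ))) e) σ
∑-vanish F p e (true ∷ σ)  = ∑-vanish (λ τ → F (true ∷ τ)) (λ τ → p (true ∷ τ))
  (+-vanishʳ (∑ (λ τ → F (false ∷ τ))) (∑ (λ τ → F (true ∷ τ)))
    (∑-nonneg _ (λ τ → p (false ∷ τ))) (∑-nonneg _ (λ τ → p (true ∷ τ))) e) σ

-- Densities, null events and divergence on a finite algebra.

𝔼-cong : (P g F : Atom m → ℝ) → (∀ σ → g σ * P σ ≃ F σ) → 𝔼 P g ≃ ∑ F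
𝔼-cong P g F = ∑-cong (λ σ → g σ * P σ) F

-- Recursion on the bits makes sums over this event reduce along with `∑`: in the half that misses
-- the atom the summand is `0ℝ` by computation.
singleton : Atom m → Event m
singleton []          []          = true
singleton (false ∷ σ) (false ∷ τ) = singleton σ τ
singleton (true ∷ σ)  (true ∷ τ)  = singleton σ τ
singleton (false ∷ σ) (true ∷ τ)  = false
singleton (true ∷ σ)  (false ∷ τ) = false

∑-singleton : (σ : Atom m) (F : Atom m → ℝ) → ∑ (λ τ → if singleton σ τ then F τ else 0ℝ) ≃ F σ
∑-singleton []          F = ≃-refl
∑-singleton {suc m} (false ∷ σ) F = ∑-falseHalf (λ τ → if singleton (false ∷ σ) τ then F τ else 0ℝ) (F (false ∷ σ))
  (∑-singleton σ (λ τ → F (false ∷ τ))) (∑-zero m)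
∑-singleton {suc m} (true ∷ σ) F = ∑-trueHalf (λ τ → if singleton (true ∷ σ) τ then F τ else 0ℝ) (F (true ∷ σ))
  (∑-zero m) (∑-singleton σ (λ τ → F (true ∷ τ)))

module _ {m} (P Q f : Atom m → ℝ) where

  -- The defining identity of a density is tested on the event containing `σ` alone.
  density⇒pointwise : IsRadonNikodym P Q f → ∀ σ → P σ ≃ f σ * Q σ
  density⇒pointwise (_ , e) σ = begin
    P σ                                                ≈⟨ *-identityˡ (P σ) ⟨
    1ℝ * P σ                                           ≈⟨ ∑-singleton σ (λ τ → 1ℝ * P τ) ⟨
    measure P (singleton σ)                            ≈⟨ ⟦ e (singleton σ) ⟧ ⟩
    ∫ (singleton σ) f Q                                ≈⟨ ∑-singleton σ (λ τ → f τ * Q τ) ⟩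
    f σ * Q σ                                          ∎

  pointwise⇒density : (∀ σ → 0ℝ ≤ f σ) → (∀ σ → P σ ≃ f σ * Q σ) → IsRadonNikodym P Q f
  pointwise⇒density 0≤f P≃fQ = 0≤f , λ E → unwrap (∑-cong _ _ λ σ → term (E σ) σ)
    where
    term : ∀ b σ → (if b then 1ℝ * P σ else 0ℝ) ≃ (if b then f σ * Q σ else 0ℝ)
    term true  σ = ≃-trans (*-identityˡ (P σ)) (P≃fQ σ)
    term false σ = ≃-refl

-- The measure of `E` is a vanishing sum of nonnegative terms, and the term at `σ` is the mass of
-- `σ`.
null-event : (P : Atom m → ℝ) → (∀ σ → 0ℝ ≤ P σ) → (E : Event m) →
             measure P E ≈ 0ℝ → ∀ σ → E σ ≡ true → P σ ≃ 0ℝ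
null-event P 0≤P E e σ Eσ = ≃-trans (≃-sym (*-identityˡ (P σ)))
  (subst (λ b → (if b then 1ℝ * P σ else 0ℝ) ≃ 0ℝ) Eσ (∑-vanish (λ τ → if E τ then 1ℝ * P τ else 0ℝ) (λ τ → 0≤term (E τ) τ) ⟦ e ⟧ σ))
  where
  0≤term : ∀ b τ → 0ℝ ≤ (if b then 1ℝ * P τ else 0ℝ)
  0≤term true  τ = ≤-respʳ-≃ (P τ) (1ℝ * P τ) (0≤P τ) (≃-sym (*-identityˡ (P τ)))
  0≤term false τ = 0≤0

pointwise⇒≪ : (P Q f : Atom m → ℝ) → (∀ σ → 0ℝ ≤ Q σ) → (∀ σ → P σ ≃ f σ * Q σ) → P ≪ Q
pointwise⇒≪ {m} P Q f 0≤Q P≃fQ E QE≈0 =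
  unwrap (≃-trans (∑-cong _ _ (λ σ → term σ (E σ) refl)) (∑-zero m))
  where
  term : ∀ σ b → E σ ≡ b → (if b then 1ℝ * P σ else 0ℝ) ≃ 0ℝ
  term σ false Eσ = ≃-refl
  term σ true  Eσ = begin
    1ℝ * P σ    ≈⟨ *-identityˡ (P σ) ⟩
    P σ         ≈⟨ P≃fQ σ ⟩
    f σ * Q σ   ≈⟨ *-congˡ (f σ) (Q σ) 0ℝ (null-event Q 0≤Q E QE≈0 σ Eσ) ⟩
    f σ * 0ℝ    ≈⟨ *-zeroʳ (f σ) ⟩
    0ℝ          ∎

-- The exceptional event of `IsLog` is null, so it contains no atom of positive mass.
log-on-support : (P f g : Atom m → ℝ) → (∀ σ → 0ℝ ≤ P σ) → IsLog P f g → ∀ σ → 0ℝ < P σ →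
                 Σ (0ℝ < f σ) λ 0<f → g σ ≈ ln (f σ) 0<f
log-on-support P f g 0≤P (E , null , logs) σ 0<Pσ = logs σ (certain (E σ) refl)
  where
  certain : ∀ b → E σ ≡ b → E σ ≡ true
  certain true  Eσ = Eσ
  certain false Eσ = ⊥-elim (<⇒≄ (P σ) 0<Pσ (null-event P 0≤P (not ∘ E) null σ (cong not Eσ)))

*-null : ∀ x y z → z ≃ 0ℝ → x * z ≃ y * z
*-null x y z z≃0 = begin
  x * z     ≈⟨ *-congˡ x z 0ℝ z≃0 ⟩
  x * 0ℝ    ≈⟨ *-zeroʳ x ⟩
  0ℝ        ≈⟨ *-zeroʳ y ⟨
  y * 0ℝ    ≈⟨ *-congˡ y z 0ℝ z≃0 ⟨
  y * z     ∎

-- The support hypothesis supplies a case distinction that is not decidable for Cauchy reals. On a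
-- null atom the integrand is irrelevant; on the others `Q σ` can be cancelled, which forces any
-- density to agree with `f`. Conversely `f` and its logarithm, taken on the full event, are
-- witnesses.
divergence-of-density : (P Q f : Atom m → ℝ) (0<f : ∀ σ → 0ℝ < f σ) →
  (∀ σ → 0ℝ ≤ P σ) → (∀ σ → 0ℝ ≤ Q σ) → (∀ σ → P σ ≃ f σ * Q σ) →
  (∀ σ → P σ ≃ 0ℝ ⊎ (0ℝ < P σ × 0ℝ < Q σ)) →
  ∀ d → IsDivergence P Q d ⇔ d ≃ 𝔼 P (λ σ → ln (f σ) (0<f σ))
divergence-of-density {m} P Q f 0<f 0≤P 0≤Q P≃fQ support d = mk⇔ unique
  (λ d≃ → pointwise⇒≪ P Q f 0≤Q P≃fQ , f , (λ σ → ln (f σ) (0<f σ))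
        , pointwise⇒density P Q f (λ σ → <⇒≤ (f σ) (0<f σ)) P≃fQ
        , ((λ _ → true) , unwrap (∑-zero m) , λ σ _ → 0<f σ , unwrap (≃-refl {ln (f σ) (0<f σ)})) , unwrap d≃)
  where
  unique : IsDivergence P Q d → d ≃ 𝔼 P (λ σ → ln (f σ) (0<f σ))
  unique (_ , f′ , g , density , isLog , d≈) = ≃-trans ⟦ d≈ ⟧
    (∑-cong (λ σ → g σ * P σ) (λ σ → ln (f σ) (0<f σ) * P σ) λ σ → term σ (support σ))
    where
    term : ∀ σ → P σ ≃ 0ℝ ⊎ (0ℝ < P σ × 0ℝ < Q σ) → g σ * P σ ≃ ln (f σ) (0<f σ) * P σ
    term σ (inj₁ P≃0) = *-null (g σ) (ln (f σ) (0<f σ)) (P σ) P≃0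
    term σ (inj₂ (0<P , 0<Q)) =
      let 0<f′ , g≈ = log-on-support P f′ g 0≤P isLog σ 0<P
          f′≃f = *-cancelʳ (f′ σ) (f σ) (Q σ) 0<Q
                   (≃-trans (≃-sym (density⇒pointwise P Q f′ density σ)) (P≃fQ σ))
      in *-congʳ (P σ) (g σ) (ln (f σ) (0<f σ))
           (≃-trans {y = ln (f′ σ) 0<f′} ⟦ g≈ ⟧ (ln-cong (f′ σ) (f σ) 0<f′ (0<f σ) f′≃f))

-- Atoms below a given string.

-- The length bound excludes the case in which the cylinder of `σ` properly contains that of `τ`.
∩-atom : (σ : Atom m) (τ : String) → length τ ℕ.≤ m →
         (toList σ ∩ τ ≡ nothing) ⊎ (toList σ ∩ τ ≡ just (toList σ))
∩-atom []          []          _         = inj₂ refl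
∩-atom (b ∷ σ)     []          _         = inj₂ refl
∩-atom (false ∷ σ) (true ∷ τ)  _         = inj₁ refl
∩-atom (true ∷ σ)  (false ∷ τ) _         = inj₁ refl
∩-atom (false ∷ σ) (false ∷ τ) (s≤s τ≤m) = Sum.map (cong (Maybe.map (false ∷_))) (cong (Maybe.map (false ∷_))) (∩-atom σ τ τ≤m)
∩-atom (true ∷ σ)  (true ∷ τ)  (s≤s τ≤m) = Sum.map (cong (Maybe.map (true ∷_))) (cong (Maybe.map (true ∷_))) (∩-atom σ τ τ≤m)

maybe-map : ∀ (k : String → ℝ) (g : String → String) s →
            maybe′ k 0ℝ (Maybe.map g s) ≡ maybe′ (λ ρ → k (g ρ)) 0ℝ s
maybe-map k g (just _) = refl
maybe-map k g nothing  = refl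

-- For `τ` no longer than the atoms this is `k` on the atoms extending `τ` and zero elsewhere; `∩`
-- is used to match the shape of `conditional`.
extending : (String → ℝ) → String → Atom m → ℝ
extending k τ σ = maybe′ k 0ℝ (toList σ ∩ τ)

extending-∷ : ∀ b (σ : Atom m) τ k →
  extending k (b ∷ τ) (b ∷ σ) ≡ extending (λ ρ → k (b ∷ ρ)) τ σ
extending-∷ false σ τ k = maybe-map k (false ∷_) (toList σ ∩ τ)
extending-∷ true  σ τ k = maybe-map k (true ∷_) (toList σ ∩ τ)

-- Exactly two atoms of length `suc n` extend a string of length `n`. Each bit of `τ` discards one
-- half of the sum and is then absorbed into `k`.
∑-extending : ∀ {n} (τ : String) → length τ ≡ n → (k : String → ℝ) →
  ∑ {suc n} (extending k τ) ≃ k (τ ∷ʳ false) + k (τ ∷ʳ true)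
∑-extending {zero}  []      refl k = ≃-pointwise λ _ → refl
∑-extending {suc n} (b ∷ τ) refl k = ≃-trans (byHead b) (≃-pointwise λ _ → refl)
  where
  agree : ∀ b → ∑ {suc n} (λ σ → extending k (b ∷ τ) (b ∷ σ))
                  ≃ k (b ∷ (τ ∷ʳ false)) + k (b ∷ (τ ∷ʳ true))
  agree b = ≃-trans
    (∑-cong {suc n} (λ σ → extending k (b ∷ τ) (b ∷ σ)) (extending (λ ρ → k (b ∷ ρ)) τ)
      λ σ → ≡⇒≃ (extending-∷ b σ τ k))
    (∑-extending {n} τ refl (λ ρ → k (b ∷ ρ)))
  byHead : ∀ b → ∑ {suc (suc n)} (extending k (b ∷ τ)) ≃ k (b ∷ (τ ∷ʳ false)) + k (b ∷ (τ ∷ʳ true))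
  byHead false = ∑-falseHalf {suc n} (extending k (false ∷ τ))
    (k (false ∷ (τ ∷ʳ false)) + k (false ∷ (τ ∷ʳ true))) (agree false)
    (∑-null {suc n} (λ σ → extending k (false ∷ τ) (true ∷ σ)) (λ _ → ≃-refl))
  byHead true  = ∑-trueHalf {suc n} (extending k (true ∷ τ))
    (k (true ∷ (τ ∷ʳ false)) + k (true ∷ (τ ∷ʳ true)))
    (∑-null {suc n} (λ σ → extending k (true ∷ τ) (false ∷ σ)) (λ _ → ≃-refl)) (agree true)

-- Conditional measures on cylinders.

module _ (ν : ProbabilityMeasure) (ν>0 : FullSupport ν) (τ : String) where

  conditional-outside : ∀ σ → σ ∩ τ ≡ nothing → conditional ν ν>0 τ σ ≃ 0ℝ
  conditional-outside σ e = ≃-pointwise λ n → trans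
    (cong (λ s → seq (maybe′ (ν ⟨_⟩) 0ℝ s) n ℚ.* recip (seq (ν ⟨ τ ⟩) n)) e)
    (ℚₚ.*-zeroˡ (recip (seq (ν ⟨ τ ⟩) n)))

  conditional-inside : ∀ σ → σ ∩ τ ≡ just σ →
                       conditional ν ν>0 τ σ ≃ (ν ⟨ σ ⟩ / ν ⟨ τ ⟩ [ ν>0 τ ])
  conditional-inside σ e = ≃-pointwise λ n →
    cong (λ s → seq (maybe′ (ν ⟨_⟩) 0ℝ s) n ℚ.* recip (seq (ν ⟨ τ ⟩) n)) e

  conditional-positive : ∀ σ → σ ∩ τ ≡ just σ → 0ℝ < conditional ν ν>0 τ σ
  conditional-positive σ e = subst (λ s → 0ℝ < (maybe′ (ν ⟨_⟩) 0ℝ s / ν ⟨ τ ⟩ [ ν>0 τ ])) (sym e)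
    (divide-pos (ν ⟨ σ ⟩) (ν ⟨ τ ⟩) (ν>0 σ) (ν>0 τ))

  conditional-nonneg : ∀ σ → (σ ∩ τ ≡ nothing) ⊎ (σ ∩ τ ≡ just σ) → 0ℝ ≤ conditional ν ν>0 τ σ
  conditional-nonneg σ (inj₁ e) = ≤-respʳ-≃ 0ℝ (conditional ν ν>0 τ σ) 0≤0 (≃-sym (conditional-outside σ e))
  conditional-nonneg σ (inj₂ e) = <⇒≤ (conditional ν ν>0 τ σ) (conditional-positive σ e)

  conditional-children :
    (ν ⟨ τ ∷ʳ false ⟩ / ν ⟨ τ ⟩ [ ν>0 τ ]) + (ν ⟨ τ ∷ʳ true ⟩ / ν ⟨ τ ⟩ [ ν>0 τ ]) ≃ 1ℝ
  conditional-children = begin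
    (ν ⟨ τ ∷ʳ false ⟩ / ν ⟨ τ ⟩ [ ν>0 τ ]) + (ν ⟨ τ ∷ʳ true ⟩ / ν ⟨ τ ⟩ [ ν>0 τ ])
      ≈⟨ /-distribʳ-+ (ν ⟨ τ ∷ʳ false ⟩) (ν ⟨ τ ∷ʳ true ⟩) (ν ⟨ τ ⟩) (ν>0 τ) ⟨
    (ν ⟨ τ ∷ʳ false ⟩ + ν ⟨ τ ∷ʳ true ⟩) / ν ⟨ τ ⟩ [ ν>0 τ ]
      ≈⟨ /-congʳ (ν ⟨ τ ⟩) (ν ⟨ τ ⟩) (ν ⟨ τ ∷ʳ false ⟩ + ν ⟨ τ ∷ʳ true ⟩) (ν>0 τ) ⟦ ProbabilityMeasure.additive ν τ ⟧ ⟨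
    ν ⟨ τ ⟩ / ν ⟨ τ ⟩ [ ν>0 τ ]
      ≈⟨ *-inverse (ν ⟨ τ ⟩) (ν>0 τ) ⟩
    1ℝ ∎

-- Divergence of the conditional measures in terms of the log ratio.

module _ (ν μ : ProbabilityMeasure) (ν>0 : FullSupport ν) (μ>0 : FullSupport μ) where

  0<ratio : ∀ σ → 0ℝ < μ ⟨ σ ⟩ / ν ⟨ σ ⟩ [ ν>0 σ ]
  0<ratio σ = divide-pos (μ ⟨ σ ⟩) (ν ⟨ σ ⟩) (μ>0 σ) (ν>0 σ)

  -- Inside [τ] this is ν(σ ∣ τ) / μ(σ ∣ τ); its values outside [τ], a null set
  -- for both conditional measures, only have to be positive.
  density : String → String → ℝ
  density τ σ = (μ ⟨ τ ⟩ / ν ⟨ τ ⟩ [ ν>0 τ ]) / (μ ⟨ σ ⟩ / ν ⟨ σ ⟩ [ ν>0 σ ]) [ 0<ratio σ ]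

  0<density : ∀ τ σ → 0ℝ < density τ σ
  0<density τ σ = divide-pos (μ ⟨ τ ⟩ / ν ⟨ τ ⟩ [ ν>0 τ ]) (μ ⟨ σ ⟩ / ν ⟨ σ ⟩ [ ν>0 σ ]) (0<ratio τ) (0<ratio σ)

  conditional-density : ∀ σ τ → (σ ∩ τ ≡ nothing) ⊎ (σ ∩ τ ≡ just σ) →
    conditional ν ν>0 τ σ ≃ density τ σ * conditional μ μ>0 τ σ
  conditional-density σ τ (inj₁ e) = begin
    conditional ν ν>0 τ σ                 ≈⟨ conditional-outside ν ν>0 τ σ e ⟩
    0ℝ                                    ≈⟨ *-zeroʳ (density τ σ) ⟨
    density τ σ * 0ℝ                      ≈⟨ *-congˡ (density τ σ) (conditional μ μ>0 τ σ) 0ℝ (conditional-outside μ μ>0 τ σ e) ⟨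
    density τ σ * conditional μ μ>0 τ σ   ∎
  conditional-density σ τ (inj₂ e) = begin
    conditional ν ν>0 τ σ                         ≈⟨ conditional-inside ν ν>0 τ σ e ⟩
    ν ⟨ σ ⟩ / ν ⟨ τ ⟩ [ ν>0 τ ]                   ≈⟨ ≃-trans (quotient-of-ratios (ν ⟨ σ ⟩) (μ ⟨ τ ⟩) (ν ⟨ τ ⟩) (μ ⟨ σ ⟩) (ν>0 σ) (μ>0 τ) (ν>0 τ) (0<ratio σ))
                                                             (≃-pointwise λ _ → refl) ⟩
    density τ σ * (μ ⟨ σ ⟩ / μ ⟨ τ ⟩ [ μ>0 τ ])   ≈⟨ *-congˡ (density τ σ) (conditional μ μ>0 τ σ) (μ ⟨ σ ⟩ / μ ⟨ τ ⟩ [ μ>0 τ ]) (conditional-inside μ μ>0 τ σ e) ⟨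
    density τ σ * conditional μ μ>0 τ σ           ∎

  -- Full support gives both measures positive mass inside the cylinder of `τ`, which is the
  -- dichotomy that `divergence-of-density` asks for.
  conditional-support : ∀ σ τ → (σ ∩ τ ≡ nothing) ⊎ (σ ∩ τ ≡ just σ) →
    conditional ν ν>0 τ σ ≃ 0ℝ ⊎ (0ℝ < conditional ν ν>0 τ σ × 0ℝ < conditional μ μ>0 τ σ)
  conditional-support σ τ = Sum.map (conditional-outside ν ν>0 τ σ)
    (λ e → conditional-positive ν ν>0 τ σ e , conditional-positive μ μ>0 τ σ e)

  conditional-divergence : ∀ {m} τ → length τ ℕ.≤ m → ∀ d →
    IsDivergence (restrict m (conditional ν ν>0 τ)) (restrict m (conditional μ μ>0 τ)) d ⇔
    d ≃ 𝔼 (restrict m (conditional ν ν>0 τ)) (λ σ → ln (density τ (toList σ)) (0<density τ (toList σ)))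
  conditional-divergence {m} τ τ≤m = divergence-of-density
    (restrict m (conditional ν ν>0 τ)) (restrict m (conditional μ μ>0 τ)) (λ σ → density τ (toList σ))
    (λ σ → 0<density τ (toList σ))
    (λ σ → conditional-nonneg ν ν>0 τ (toList σ) (∩-atom σ τ τ≤m))
    (λ σ → conditional-nonneg μ μ>0 τ (toList σ) (∩-atom σ τ τ≤m))
    (λ σ → ≃-trans (conditional-density (toList σ) τ (∩-atom σ τ τ≤m)) (≃-pointwise λ _ → refl))
    (λ σ → conditional-support (toList σ) τ (∩-atom σ τ τ≤m))

  private
    L : String → ℝ
    L = negLogRatio ν μ ν>0 μ>0

  -- The two sides carry positivity proofs written differently; only their approximating sequences
  -- have to be compared.
  L-ln : ∀ σ → L σ ≃ - ln (μ ⟨ σ ⟩ / ν ⟨ σ ⟩ [ ν>0 σ ]) (0<ratio σ)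
  L-ln σ = ≃-trans
    (≃-refl { - ln (μ ⟨ σ ⟩ / ν ⟨ σ ⟩ [ ν>0 σ ]) (divide-pos (μ ⟨ σ ⟩) (ν ⟨ σ ⟩) (μ>0 σ) (ν>0 σ))})
    (-‿cong (ln (μ ⟨ σ ⟩ / ν ⟨ σ ⟩ [ ν>0 σ ]) (divide-pos (μ ⟨ σ ⟩) (ν ⟨ σ ⟩) (μ>0 σ) (ν>0 σ)))
      (ln (μ ⟨ σ ⟩ / ν ⟨ σ ⟩ [ ν>0 σ ]) (0<ratio σ))
      (ln-irrelevant (μ ⟨ σ ⟩ / ν ⟨ σ ⟩ [ ν>0 σ ])
        (divide-pos (μ ⟨ σ ⟩) (ν ⟨ σ ⟩) (μ>0 σ) (ν>0 σ)) (0<ratio σ)))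

  -- The density times the ratio `μ/ν` at `σ` is the ratio at `τ`; the minus sign in `L` exchanges
  -- the two logarithms.
  ln-density : ∀ τ σ → ln (density τ σ) (0<density τ σ) ≃ L σ - L τ
  ln-density τ σ = begin
    ln (density τ σ) (0<density τ σ)
      ≈⟨ ln-quotient (density τ σ) (μ ⟨ τ ⟩ / ν ⟨ τ ⟩ [ ν>0 τ ]) (μ ⟨ σ ⟩ / ν ⟨ σ ⟩ [ ν>0 σ ])
           (0<density τ σ) (0<ratio τ) (0<ratio σ)
           (≃-trans (≃-pointwise λ _ → refl)
             (/-* (μ ⟨ τ ⟩ / ν ⟨ τ ⟩ [ ν>0 τ ]) (μ ⟨ σ ⟩ / ν ⟨ σ ⟩ [ ν>0 σ ]) (0<ratio σ))) ⟩
    ln (μ ⟨ τ ⟩ / ν ⟨ τ ⟩ [ ν>0 τ ]) (0<ratio τ) - ln (μ ⟨ σ ⟩ / ν ⟨ σ ⟩ [ ν>0 σ ]) (0<ratio σ)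
      ≈⟨ minus-neg (ln (μ ⟨ τ ⟩ / ν ⟨ τ ⟩ [ ν>0 τ ]) (0<ratio τ)) (ln (μ ⟨ σ ⟩ / ν ⟨ σ ⟩ [ ν>0 σ ]) (0<ratio σ)) ⟩
    - ln (μ ⟨ σ ⟩ / ν ⟨ σ ⟩ [ ν>0 σ ]) (0<ratio σ) - - ln (μ ⟨ τ ⟩ / ν ⟨ τ ⟩ [ ν>0 τ ]) (0<ratio τ)
      ≈⟨ minus-cong (L σ) (- ln (μ ⟨ σ ⟩ / ν ⟨ σ ⟩ [ ν>0 σ ]) (0<ratio σ))
           (L τ) (- ln (μ ⟨ τ ⟩ / ν ⟨ τ ⟩ [ ν>0 τ ]) (0<ratio τ)) (L-ln σ) (L-ln τ) ⟨
    L σ - L τ ∎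

  -- The contribution of a cylinder `σ` below `τ` to the divergence: log density times conditional
  -- probability.
  weight : String → String → ℝ
  weight τ σ = (L σ - L τ) * (ν ⟨ σ ⟩ / ν ⟨ τ ⟩ [ ν>0 τ ])

  -- Brings the integrand into the form `extending (weight τ) τ`, whose sum `∑-extending` evaluates.
  weighted-log : ∀ σ τ → (σ ∩ τ ≡ nothing) ⊎ (σ ∩ τ ≡ just σ) →
    ln (density τ σ) (0<density τ σ) * conditional ν ν>0 τ σ ≃ maybe′ (weight τ) 0ℝ (σ ∩ τ)
  weighted-log σ τ (inj₁ e) = begin
    ln (density τ σ) (0<density τ σ) * conditional ν ν>0 τ σ
      ≈⟨ *-congˡ (ln (density τ σ) (0<density τ σ)) (conditional ν ν>0 τ σ) 0ℝ (conditional-outside ν ν>0 τ σ e) ⟩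
    ln (density τ σ) (0<density τ σ) * 0ℝ
      ≈⟨ *-zeroʳ (ln (density τ σ) (0<density τ σ)) ⟩
    0ℝ
      ≈⟨ ≡⇒≃ (cong (maybe′ (weight τ) 0ℝ) e) ⟨
    maybe′ (weight τ) 0ℝ (σ ∩ τ) ∎
  weighted-log σ τ (inj₂ e) = begin
    ln (density τ σ) (0<density τ σ) * conditional ν ν>0 τ σ
      ≈⟨ *-cong (ln (density τ σ) (0<density τ σ)) (L σ - L τ) (conditional ν ν>0 τ σ) (ν ⟨ σ ⟩ / ν ⟨ τ ⟩ [ ν>0 τ ])
           (ln-density τ σ) (conditional-inside ν ν>0 τ σ e) ⟩
    (L σ - L τ) * (ν ⟨ σ ⟩ / ν ⟨ τ ⟩ [ ν>0 τ ])
      ≈⟨ ≡⇒≃ (cong (maybe′ (weight τ) 0ℝ) e) ⟨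
    maybe′ (weight τ) 0ℝ (σ ∩ τ) ∎

  expected-log-density : ∀ {n} τ → length τ ≡ n →
    𝔼 (restrict (suc n) (conditional ν ν>0 τ)) (λ σ → ln (density τ (toList σ)) (0<density τ (toList σ)))
      ≃ conditionalMean ν ν>0 (negLogRatio ν μ ν>0 μ>0) τ - negLogRatio ν μ ν>0 μ>0 τ
  expected-log-density {n} τ len = begin
    𝔼 (restrict (suc n) (conditional ν ν>0 τ)) (λ σ → ln (density τ (toList σ)) (0<density τ (toList σ)))
      ≈⟨ 𝔼-cong (restrict (suc n) (conditional ν ν>0 τ)) (λ σ → ln (density τ (toList σ)) (0<density τ (toList σ)))
           (extending (weight τ) τ) term ⟩
    ∑ {suc n} (extending (weight τ) τ)
      ≈⟨ ∑-extending {n} τ len (weight τ) ⟩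
    weight τ (τ ∷ʳ false) + weight τ (τ ∷ʳ true)
      ≈⟨ +-cong (weight τ (τ ∷ʳ false)) ((L (τ ∷ʳ false) - L τ) * p₀) (weight τ (τ ∷ʳ true)) ((L (τ ∷ʳ true) - L τ) * p₁)
           (≃-pointwise λ _ → refl) (≃-pointwise λ _ → refl) ⟩
    (L (τ ∷ʳ false) - L τ) * p₀ + (L (τ ∷ʳ true) - L τ) * p₁
      ≈⟨ weighted-difference (L (τ ∷ʳ false)) (L (τ ∷ʳ true)) (L τ) p₀ p₁ p₀+p₁≃1 ⟩
    (L (τ ∷ʳ false) * p₀ + L (τ ∷ʳ true) * p₁) - L τ
      ≈⟨ minus-cong (L (τ ∷ʳ false) * p₀ + L (τ ∷ʳ true) * p₁) (conditionalMean ν ν>0 (negLogRatio ν μ ν>0 μ>0) τ)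
           (L τ) (negLogRatio ν μ ν>0 μ>0 τ) (≃-pointwise λ _ → refl) (≃-refl {negLogRatio ν μ ν>0 μ>0 τ}) ⟩
    conditionalMean ν ν>0 (negLogRatio ν μ ν>0 μ>0) τ - negLogRatio ν μ ν>0 μ>0 τ ∎
    where
    p₀ = ν ⟨ τ ∷ʳ false ⟩ / ν ⟨ τ ⟩ [ ν>0 τ ]
    p₁ = ν ⟨ τ ∷ʳ true ⟩ / ν ⟨ τ ⟩ [ ν>0 τ ]
    p₀+p₁≃1 : p₀ + p₁ ≃ 1ℝ
    p₀+p₁≃1 = ≃-trans (≃-pointwise λ _ → refl) (conditional-children ν ν>0 τ)
    term : ∀ σ → ln (density τ (toList σ)) (0<density τ (toList σ)) * restrict (suc n) (conditional ν ν>0 τ) σ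
                   ≃ extending (weight τ) τ σ
    term σ = ≃-trans
      (*-congˡ (ln (density τ (toList σ)) (0<density τ (toList σ)))
        (restrict (suc n) (conditional ν ν>0 τ) σ) (conditional ν ν>0 τ (toList σ)) (≃-refl {conditional ν ν>0 τ (toList σ)}))
      -- The atoms have length `suc n`, one more than `τ`, so the length bound holds with room to
      -- spare.
      (weighted-log (toList σ) τ (∩-atom σ τ (ℕₚ.m≤n⇒m≤1+n (ℕₚ.≤-reflexive len))))

-- Divergence is a relation between measures and a real, so the equivalence asserts both that the
-- increment of `A` is a value of the divergence and that every value equals it.
theorem3p4 : (ν μ : ProbabilityMeasure) → IsComputable (ν ⟨_⟩) → IsComputable (μ ⟨_⟩) →
    (ν>0 : FullSupport ν) (μ>0 : FullSupport μ) →
    (N A : String → ℝ) → IsDoobDecomposition ν ν>0 (negLogRatio ν μ ν>0 μ>0) N A →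
    (n : ℕ) (ω : ℕ → Bool) (d : ℝ) →
    DivergenceAt ν μ ν>0 μ>0 n ω d ⇔ d ≈ A (ω ↾ suc n) - A (ω ↾ n)
theorem3p4 ν μ _ _ ν>0 μ>0 N A doob n ω d = mk⇔
  (λ D → unwrap (≃-trans (to D) value))
  (λ d≈ → from (≃-trans ⟦ d≈ ⟧ (≃-sym value)))
  where
  len = length-applyUpTo ω n
  open Equivalence (conditional-divergence ν μ ν>0 μ>0 {suc n} (ω ↾ n) (ℕₚ.m≤n⇒m≤1+n (ℕₚ.≤-reflexive len)) d)
  increment : A ((ω ↾ n) ∷ʳ ω n) - A (ω ↾ n)
                ≃ conditionalMean ν ν>0 (negLogRatio ν μ ν>0 μ>0) (ω ↾ n) - negLogRatio ν μ ν>0 μ>0 (ω ↾ n)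
  -- The bit taken is the next bit of `ω`; the right-hand side is the same for both bits, which is
  -- the predictability of `A`.
  increment = ⟦ IsDoobDecomposition.increment doob (ω ↾ n) (ω n) ⟧
  value : 𝔼 (restrict (suc n) (conditional ν ν>0 (ω ↾ n)))
            (λ σ → ln (density ν μ ν>0 μ>0 (ω ↾ n) (toList σ)) (0<density ν μ ν>0 μ>0 (ω ↾ n) (toList σ)))
          ≃ A (ω ↾ suc n) - A (ω ↾ n)
  value = ≃-trans (expected-log-density ν μ ν>0 μ>0 {n} (ω ↾ n) len) (≃-trans (≃-sym increment)
    -- `ω ↾ suc n` is built from its first bit, so appending `ω n` at the end agrees with it only
    -- propositionally.
    (≡⇒≃ (cong (λ σ → A σ - A (ω ↾ n)) (applyUpTo-∷ʳ ω n))))
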